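{- Let $G=(V,E)$ be the medial graph of a plane cubic graph and let $\gamma$ be the orientation of $G$ directing the edges of $G$ clockwise around black triangles. Then, choosing an orientation $\alpha$ of $G$ uniformly at random (among all $2^{|E|}$ orientations), the event $\Sigma$ that $\alpha$ agrees with $\gamma$ on an even number of edges and the event $\Gamma$ that $\alpha$ is eulerian have correlation given by $$\mathrm{Bias}(\Sigma\mid\Gamma)=\frac{P(G;3)}{F(G;3)}.$$
   Context: Graphs are finite; loops and parallel edges are permitted. Let $H$ be a graph embedded in an orientable surface (here: a cubic graph embedded in the plane). The medial graph $M(H)$ has one vertex placed on each edge of $H$; vertices $e,f$ of $M(H)$ are joined by an edge for each way of drawing a line joining $e$ and $f$ along incident edges $e,f$ of $H$ without crossing edges of $H$, i.e. there is one edge of $M(H)$ for each corner of $H$ (each pair of edges consecutive in the rotation at a vertex of $H$); in particular two edges can be joined by parallel edges. $M(H)$ is $4$-regular and embedded in the same surface. When $H$ is cubic, each vertex $v$ of $H$ lies in the interior of a triangle of $M(H)$ formed by the three edges of $M(H)$ corresponding to the three corners at $v$; these are the black triangles of $M(H)$, and every edge of $M(H)$ belongs to exactly one of them. The orientation $\gamma$ directs the edges of each black triangle clockwise. An orientation of $G$ is eulerian if each vertex has the same number of incoming and outgoing edges. $P(G;q)$ is the number of proper vertex $q$-colourings of $G$; $F(G;q)$ is the number of nowhere-zero $\mathbb{Z}_q$-flows of $G$ (with respect to any fixed orientation). $\mathrm{Bias}(\Sigma\mid\Gamma)=\mathbb{P}(\Sigma\mid\Gamma)-\mathbb{P}(\overline{\Sigma}\mid\Gamma)$,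 where $\overline{\Sigma}$ is the complement of $\Sigma$. -}

module Defs where

open import Algebra.Properties.CommutativeMonoid.Sum using (sum)
open import Data.Bool using (if_then_else_)
open import Data.Fin using (Fin; toℕ; opposite; remQuot; finToFun; _≟_)
open import Data.Fin.Patterns using (0F; 1F)
open import Data.Fin.Properties using (all?)
open import Data.Integer using (+_)
open import Data.Nat as ℕ using (ℕ; _+_; _*_; _^_; _%_; NonZero)
open import Data.Nat.Divisibility using (_∣_; _∣?_)
open import Data.Nat.GeneralisedArithmetic using (iterate)
open import Data.Nat.Properties using (+-0-commutativeMonoid; m^n≢0)
open import Data.Product using (_×_; _,_; proj₁; proj₂; ∃-syntax)
open import Data.Rational as ℚ using (ℚ)
open import Function using (_↔_; module Inverse)
open import Function.Bundles using (Bijection)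
open import Level using (0ℓ)
open import Relation.Binary.Bundles using (Setoid)
open import Relation.Binary.Construct.Closure.Equivalence using () renaming (setoid to closureSetoid)
open import Relation.Binary.PropositionalEquality using (_≡_; _≢_; setoid)
open import Relation.Nullary using (does; ¬?)
open import Relation.Nullary.Decidable using (_×-dec_)
open import Relation.Unary using (Pred; Decidable)
open import Relation.Unary.Properties using (∁?; _∩?_)

∑ : ∀ {n} → (Fin n → ℕ) → ℕ
∑ = sum +-0-commutativeMonoid

count : ∀ {n} {P : Pred (Fin n) 0ℓ} → Decidable P → ℕ
count P? = ∑ (λ i → if does (P? i) then 1 else 0)

-- Functions Fin m → Fin n are enumerated by their codes in Fin (n ^ m).
countFun : ∀ {m n} {P : Pred (Fin m → Fin n) 0ℓ} → Decidable P → ℕ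
countFun {m} {n} P? = count {n ^ m} (λ i → P? (finToFun i))

-- Finite multigraphs: each edge e has two ends, at the vertices end e 0F and
-- end e 1F.  Loops and parallel edges are allowed.
record Graph : Set where
  field
    nV nE : ℕ
    end   : Fin nE → Fin 2 → Fin nV

open Graph

-- A dart (half-edge) is an edge together with one of its ends.
Dart : Graph → Set
Dart H = Fin (nE H) × Fin 2

vertexOf : (H : Graph) → Dart H → Fin (nV H)
vertexOf H (e , s) = end H e s

otherEnd : (H : Graph) → Dart H → Dart H
otherEnd H (e , s) = e , opposite s

-- A loop contributes 2 to the degree of its vertex.
degree : (H : Graph) → Fin (nV H) → ℕ
degree H v = count (λ e → end H e 0F ≟ v) + count (λ e → end H e 1F ≟ v)

Cubic : Graph → Set
Cubic H = ∀ v → degree H v ≡ 3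

-- Embeddings in oriented surfaces, up to homeomorphism, given by the clockwise
-- cyclic order of the darts around each vertex.
record RotationSystem (H : Graph) : Set where
  field
    rotation : Dart H ↔ Dart H

  next : Dart H → Dart H
  next = Inverse.to rotation

  field
    next-vertex : ∀ d → vertexOf H (next d) ≡ vertexOf H d
    next-cyclic : ∀ d d′ → vertexOf H d ≡ vertexOf H d′ →
                  ∃[ k ] iterate next d k ≡ d′

open RotationSystem

components : Graph → Setoid 0ℓ 0ℓ
components H = closureSetoid (λ u v → ∃[ e ] (end H e 0F ≡ u × end H e 1F ≡ v))

-- The elements, up to ≈, are the orbits of the face-tracing permutation.
faces : {H : Graph} → RotationSystem H → Setoid 0ℓ 0ℓ
faces {H} R = closureSetoid (λ d d′ → next R (otherEnd H d) ≡ d′)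

-- Euler's formula V - E + F = 2C, where F counts faces of each component
-- embedded separately.  A component of genus g contributes 2 - 2g to V - E + F,
-- so this says that every component is embedded in the sphere.  An isolated
-- vertex has no darts and hence no face here, so the formula is meant only for
-- graphs of positive minimum degree.
record Planar {H : Graph} (R : RotationSystem H) : Set where
  field
    nF nC       : ℕ
    countFaces  : Bijection (faces R) (setoid (Fin nF))
    countComps  : Bijection (components H) (setoid (Fin nC))
    euler       : nV H + nF ≡ nE H + 2 * nC

-- The corner between d and next d is represented by d, and corners are numbered
-- by the identification of Fin (nE H * 2) with Dart H.  In the medial graph this
-- corner joins the edge of d (end 0F) to the edge of next d (end 1F).
medialEnd : {H : Graph} → RotationSystem H → Fin (nE H * 2) → Fin 2 → Fin (nE H)
medialEnd {H} R c 0F = proj₁ (remQuot {nE H} 2 c)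
medialEnd {H} R c 1F = proj₁ (next R (remQuot {nE H} 2 c))

medialGraph : {H : Graph} → RotationSystem H → Graph
medialGraph {H} R = record { nV = nE H ; nE = nE H * 2 ; end = medialEnd R }

-- α e is the end of e at which the head lies; so a loop has two orientations.
Orientation : Graph → Set
Orientation G = Fin (nE G) → Fin 2

-- Around the black triangle at v, the edge given by a corner d runs from the
-- edge of d to the edge of its clockwise successor next d, that is, towards its
-- end 1F.
clockwise : {H : Graph} (R : RotationSystem H) → Orientation (medialGraph R)
clockwise R _ = 1F

head tail : (G : Graph) → Orientation G → Fin (nE G) → Fin (nV G)
head G α e = end G e (α e)
tail G α e = end G e (opposite (α e))

Eulerian : (G : Graph) → Pred (Orientation G) 0ℓ
Eulerian G α = ∀ v → count (λ e → head G α e ≟ v) ≡ count (λ e → tail G α e ≟ v)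

eulerian? : (G : Graph) → Decidable (Eulerian G)
eulerian? G α = all? (λ v → count (λ e → head G α e ≟ v) ℕ.≟ count (λ e → tail G α e ≟ v))

AgreesEvenly : (G : Graph) → Orientation G → Pred (Orientation G) 0ℓ
AgreesEvenly G γ α = 2 ∣ count (λ e → α e ≟ γ e)

agreesEvenly? : (G : Graph) (γ : Orientation G) → Decidable (AgreesEvenly G γ)
agreesEvenly? G γ α = 2 ∣? count (λ e → α e ≟ γ e)

-- Probability under the uniform distribution on the 2 ^ nE G orientations.
ℙ : (G : Graph) {A : Pred (Orientation G) 0ℓ} → Decidable A → ℚ
ℙ G A? = ℚ._/_ (+ countFun A?) (2 ^ nE G) {{m^n≢0 2 (nE G)}}

ℙ[_∣_] : {G : Graph} {A B : Pred (Orientation G) 0ℓ}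
         (A? : Decidable A) (B? : Decidable B) → .{{_ : ℚ.NonZero (ℙ G B?)}} → ℚ
ℙ[_∣_] {G} A? B? = ℙ G (A? ∩? B?) ℚ.÷ ℙ G B?

Bias : (G : Graph) {A B : Pred (Orientation G) 0ℓ}
       (A? : Decidable A) (B? : Decidable B) → .{{_ : ℚ.NonZero (ℙ G B?)}} → ℚ
Bias G A? B? = ℙ[_∣_] {G} A? B? ℚ.- ℙ[_∣_] {G} (∁? A?) B?

Proper : (G : Graph) (q : ℕ) → Pred (Fin (nV G) → Fin q) 0ℓ
Proper G q c = ∀ e → c (end G e 0F) ≢ c (end G e 1F)

proper? : (G : Graph) (q : ℕ) → Decidable (Proper G q)
proper? G q c = all? (λ e → ¬? (c (end G e 0F) ≟ c (end G e 1F)))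

P[_,_] : Graph → ℕ → ℕ
P[ G , q ] = countFun (proper? G q)

-- Elements of ℤ_q are represented by Fin q, and every edge is given the
-- reference direction from its end 0F to its end 1F.
flowThrough : (G : Graph) {q : ℕ} → (Fin (nE G) → Fin q) → Fin 2 → Fin (nV G) → ℕ
flowThrough G f s v = ∑ (λ e → if does (end G e s ≟ v) then toℕ (f e) else 0)

NowhereZeroFlow : (G : Graph) (q : ℕ) .{{_ : NonZero q}} → Pred (Fin (nE G) → Fin q) 0ℓ
NowhereZeroFlow G q f =
  (∀ e → toℕ (f e) ≢ 0) ×
  (∀ v → flowThrough G f 1F v % q ≡ flowThrough G f 0F v % q)

nowhereZeroFlow? : (G : Graph) (q : ℕ) .{{_ : NonZero q}} → Decidable (NowhereZeroFlow G q)
nowhereZeroFlow? G q f =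
  all? (λ e → ¬? (toℕ (f e) ℕ.≟ 0)) ×-dec
  all? (λ v → flowThrough G f 1F v % q ℕ.≟ flowThrough G f 0F v % q)

F[_,_] : Graph → (q : ℕ) .{{_ : NonZero q}} → ℕ
F[ G , q ] = countFun (nowhereZeroFlow? G q)

-- Since G is 4-regular, a nowhere-zero ℤ₃-flow of G is an eulerian orientation, so
-- F(G;3) = |Γ| and the claim is that the eulerian orientations α, counted with sign
-- (−1)^#{edges where α and γ agree}, sum to P(G;3).
--
-- Whether α is eulerian at an edge e of H depends only on the net flow at the two
-- darts of e.  Diagonalising this condition over ℤ makes the signed sum a sum over
-- c : E(H) → {0,1,2} of ∏ₑ η(c e) times, for each vertex of H, the trace of a
-- product of three 2 × 2 transfer matrices along its black triangle.  The trace is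
-- the sign of the cyclic order of the three colours, and 0 if two of them agree
-- (Penrose's formula), so only proper vertex 3-colourings c of G contribute.
--
-- In the plane each of them contributes 1.  Regard colours as nonzero vectors of
-- 𝔽₂².  The second coordinates form a cycle mod 2 in H, so they are the differences
-- x(f) − x(f′) across edges of some x : faces → 𝔽₂.  The sign at a vertex is the
-- product over its darts of (−1)^(x · first coordinate), and the two factors
-- belonging to an edge e multiply to η(c e).
--
-- That cycles bound follows by counting: character sums give
-- 2^V · #cycles = 2^E · #cocycles ≤ 2^(E+C), each cycle is the boundary of at most
-- 2^C of the 2^F sets of faces, and V + F = E + 2C leaves no cycle out.

module Submission where

open import Algebra.Bundles using (CommutativeMonoid; CommutativeSemiring)
open import Data.Bool using (true; false; if_then_else_; _∧_; not)
open import Data.Fin using (Fin; zero; suc; toℕ; opposite; _≟_; _↑ˡ_; _↑ʳ_; splitAt; combine; remQuot; finToFun; funToFin)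
open import Data.Fin.Patterns using (0F; 1F; 2F)
open import Data.Fin.Properties
  using (*↔×; all?; any?; ¬∀⟶∃¬; suc-injective; splitAt-↑ˡ; splitAt-↑ʳ; remQuot-combine; combine-remQuot; finToFun-funToFin; funToFin-finToFin)
open import Data.Integer as ℤ using (ℤ; 0ℤ; 1ℤ; -1ℤ)
import Data.Integer.Properties as ℤ
open import Data.Integer.Solver using (module +-*-Solver)
open import Data.Nat as ℕ using (ℕ; zero; suc; _≤_; _<_; z≤n; NonZero)
open import Data.Nat.Divisibility using (_∣?_; ∣-refl; ∣m+n∣m⇒∣n; ∣m∣n⇒∣m+n)
open import Data.Nat.GeneralisedArithmetic using (iterate)
import Data.Nat.Properties as ℕ
open import Data.Product using (_×_; _,_; proj₁; proj₂; uncurry; ∃-syntax; Σ-syntax)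
open import Data.Rational as ℚ using (ℚ; _/_; toℚᵘ)
import Data.Rational.Properties as ℚ
open import Data.Rational.Unnormalised as ℚᵘ using (mkℚᵘ; *≡*)
import Data.Rational.Unnormalised.Properties as ℚᵘ
open import Data.Sum using (_⊎_; inj₁; inj₂; [_,_])
open import Data.Vec.Functional using (_∷_; _++_)
open import Function using (_∘_; id; _↔_; _⇔_; mk⇔; mk↔ₛ′; module Inverse; module Bijection; module Equivalence)
open import Function.Construct.Composition using (_↔-∘_)
open import Function.Construct.Symmetry using (↔-sym)
open import Level using (0ℓ)
open import Relation.Binary.Construct.Closure.Equivalence using (EqClosure; return)
open import Relation.Binary.Construct.Closure.ReflexiveTransitive as Star using (_◅_)
open import Relation.Binary.Construct.Closure.Symmetric using (fwd; bwd)
open import Relation.Binary.PropositionalEquality as ≡ using (_≡_; _≢_; _≗_; module ≡-Reasoning)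
open import Relation.Nullary using (Dec; yes; no; does; ¬_; ¬?; contradiction)
open import Relation.Nullary.Decidable using (from-yes; _→-dec_; decidable-stable; does-⇔)
open import Relation.Unary using (Pred; Decidable)
open import Relation.Unary.Properties using (∁?; _∩?_)
open import Defs

-- Sums and products over function spaces

finToFun-combine : ∀ {m n} (a : Fin n) (j : Fin (n ℕ.^ m)) →
                   finToFun {n} {suc m} (combine a j) ≗ a ∷ finToFun j
finToFun-combine {m} {n} a j zero = ≡.cong proj₁ (remQuot-combine {n} a j)
finToFun-combine {m} {n} a j (suc i) = ≡.cong (λ r → finToFun {n} {m} (proj₂ r) i) (remQuot-combine {n} a j)

funToFin-cong : ∀ {m n} {f g : Fin m → Fin n} → f ≗ g → funToFin f ≡ funToFin g
funToFin-cong {zero}  f≗g = ≡.refl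
funToFin-cong {suc m} f≗g = ≡.cong₂ combine (f≗g zero) (funToFin-cong (f≗g ∘ suc))

∷-cong : ∀ {m n} (a : Fin n) {f g : Fin m → Fin n} → f ≗ g → a ∷ f ≗ a ∷ g
∷-cong a f≗g zero    = ≡.refl
∷-cong a f≗g (suc i) = f≗g i

module FiniteSums {c ℓ} (M : CommutativeMonoid c ℓ) where
  open CommutativeMonoid M
  open import Algebra.Properties.CommutativeMonoid.Sum M
  open import Relation.Binary.Reasoning.Setoid setoid

  sum-↑ : ∀ m {n} (f : Fin (m ℕ.+ n) → Carrier) →
          sum f ≈ sum (λ i → f (i ↑ˡ n)) ∙ sum (λ j → f (m ↑ʳ j))
  sum-↑ zero    f = sym (identityˡ _)
  sum-↑ (suc m) f = trans (∙-congˡ (sum-↑ m (f ∘ suc))) (sym (assoc _ _ _))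

  sum-combine : ∀ m {n} (f : Fin (m ℕ.* n) → Carrier) →
                sum f ≈ sum (λ i → sum (λ j → f (combine {m} i j)))
  sum-combine zero        f = refl
  sum-combine (suc m) {n} f = trans (sum-↑ n f) (∙-congˡ (sum-combine m (f ∘ (n ↑ʳ_))))

  sum-remQuot : ∀ m {n} (f : Fin m × Fin n → Carrier) →
                sum (f ∘ remQuot {m} n) ≈ sum (λ i → sum (λ j → f (i , j)))
  sum-remQuot m f = trans (sum-combine m _) (sum-cong-≋ {m} λ i → sum-cong-≋ λ j →
    reflexive (≡.cong f (remQuot-combine {m} i j)))

  -- The two index products may have different shapes. This is what turns a product over darts
  -- listed by edge and end into one listed by vertex and position.
  sum-reindex : ∀ {m n m′ n′ : ℕ} (f : Fin m × Fin n → Carrier) (π : (Fin m′ × Fin n′) ↔ (Fin m × Fin n)) →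
                sum (λ i → sum (λ j → f (i , j))) ≈ sum (λ i → sum (λ j → f (Inverse.to π (i , j))))
  sum-reindex {m} {n} {m′} {n′} f π = begin
    sum (λ i → sum (λ j → f (i , j)))                  ≈⟨ sum-remQuot m f ⟨
    sum (f ∘ remQuot {m} n)                            ≈⟨ sum-permute _ ρ ⟩
    sum (f ∘ remQuot {m} n ∘ Inverse.to ρ)             ≈⟨ sum-cong-≋ {m′ ℕ.* n′} (λ i → reflexive (≡.cong f (Inverse.strictlyInverseˡ (*↔× {m} {n}) (Inverse.to π (remQuot {m′} n′ i))))) ⟩
    sum (f ∘ Inverse.to π ∘ remQuot {m′} n′)           ≈⟨ sum-remQuot m′ (f ∘ Inverse.to π) ⟩
    sum (λ i → sum (λ j → f (Inverse.to π (i , j))))   ∎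
    where ρ = ↔-sym *↔× ↔-∘ (π ↔-∘ *↔×)

  -- A function recovered from its code agrees with the original only up to `≗`, so summands over
  -- function spaces have to respect `≗` before they can be split or reindexed.
  Extensional : ∀ {m n} → ((Fin m → Fin n) → Carrier) → Set _
  Extensional F = ∀ {f g} → f ≗ g → F f ≈ F g

  sumFun : ∀ {m n} → ((Fin m → Fin n) → Carrier) → Carrier
  sumFun {m} {n} F = sum {n ℕ.^ m} (F ∘ finToFun)

  sumFun-cong : ∀ {m n} {F G : (Fin m → Fin n) → Carrier} → (∀ f → F f ≈ G f) → sumFun F ≈ sumFun G
  sumFun-cong {m} {n} F≈G = sum-cong-≋ {n ℕ.^ m} (F≈G ∘ finToFun)

  sumFun-∷ : ∀ {m n} {F : (Fin (suc m) → Fin n) → Carrier} → Extensional F →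
             sumFun F ≈ sum (λ a → sumFun (λ f → F (a ∷ f)))
  sumFun-∷ {m} {n} F-ext = trans (sum-combine n _)
    (sum-cong-≋ {n} λ a → sum-cong-≋ {n ℕ.^ m} λ j → F-ext (finToFun-combine {m} a j))

  sumFun-++ : ∀ k {m n} {F : (Fin (k ℕ.+ m) → Fin n) → Carrier} → Extensional F →
              sumFun F ≈ sumFun {k} (λ f → sumFun {m} (λ g → F (f ++ g)))
  sumFun-++ zero {F = F} F-ext = sym (identityʳ _)
  sumFun-++ (suc k) {m} {n} {F = F} F-ext = begin
    sumFun F
      ≈⟨ sumFun-∷ F-ext ⟩
    sum (λ a → sumFun (λ f → F (a ∷ f)))
      ≈⟨ sum-cong-≋ {n} (λ a → sumFun-++ k (F-ext ∘ ∷-cong a)) ⟩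
    sum (λ a → sumFun {k} (λ f → sumFun {m} (λ g → F (a ∷ (f ++ g)))))
      ≈⟨ sum-cong-≋ {n} (λ a → sumFun-cong {k} (λ f → sumFun-cong {m} (λ g → F-ext (∷-++ a f g)))) ⟩
    sum (λ a → sumFun {k} (λ f → sumFun {m} (λ g → F ((a ∷ f) ++ g))))
      ≈⟨ sumFun-∷ (λ f≗f′ → sumFun-cong {m} (λ g → F-ext (++-congʳ f≗f′ g))) ⟨
    sumFun {suc k} (λ f → sumFun {m} (λ g → F (f ++ g))) ∎
    where
    ∷-++ : ∀ a (f : Fin k → Fin n) (g : Fin m → Fin n) → a ∷ (f ++ g) ≗ (a ∷ f) ++ g
    ∷-++ a f g zero = ≡.refl
    ∷-++ a f g (suc i) with splitAt k i
    ... | inj₁ _ = ≡.refl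
    ... | inj₂ _ = ≡.refl
    ++-congʳ : ∀ {f f′ : Fin (suc k) → Fin n} → f ≗ f′ → ∀ (g : Fin m → Fin n) → f ++ g ≗ f′ ++ g
    ++-congʳ f≗f′ g i with splitAt (suc k) i
    ... | inj₁ j = f≗f′ j
    ... | inj₂ _ = ≡.refl

  sumFun-reindex : ∀ {m m′ n} {F : (Fin m → Fin n) → Carrier} → Extensional F → (π : Fin m ↔ Fin m′) →
                   sumFun F ≈ sumFun (λ f → F (f ∘ Inverse.to π))
  sumFun-reindex {m} {m′} {n} {F} F-ext π = begin
    sumFun F                              ≈⟨ sum-permute {n ℕ.^ m′} _ ρ ⟩
    sum (F ∘ finToFun ∘ Inverse.to ρ)     ≈⟨ sum-cong-≋ {n ℕ.^ m′} (λ i → F-ext (finToFun-funToFin _)) ⟩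
    sumFun (λ f → F (f ∘ Inverse.to π))   ∎
    where
    ρ : Fin (n ℕ.^ m′) ↔ Fin (n ℕ.^ m)
    ρ = mk↔ₛ′ (λ i → funToFin (finToFun {n} {m′} i ∘ Inverse.to π)) (λ i → funToFin (finToFun {n} {m} i ∘ Inverse.from π))
      (λ i → ≡.trans (funToFin-cong (λ x → ≡.trans (finToFun-funToFin (finToFun {n} i ∘ Inverse.from π) _) (≡.cong (finToFun {n} i) (Inverse.strictlyInverseʳ π x)))) (funToFin-finToFin {m} i))
      (λ i → ≡.trans (funToFin-cong (λ x → ≡.trans (finToFun-funToFin (finToFun {n} i ∘ Inverse.to π) _) (≡.cong (finToFun {n} i) (Inverse.strictlyInverseˡ π x)))) (funToFin-finToFin {m′} i))

  -- Meant for nowhere-zero flows: after the zero value is discarded, a map into `Fin 3` is `suc` of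
  -- a map into `Fin 2`, that is, of an orientation.
  sumFun-nonzero : ∀ {m n} {F : (Fin m → Fin (suc n)) → Carrier} → Extensional F →
                   (∀ f i → f i ≡ zero → F f ≈ ε) → sumFun F ≈ sumFun (λ f → F (suc ∘ f))
  sumFun-nonzero {zero} F-ext F0 = ∙-congʳ (F-ext λ ())
  sumFun-nonzero {suc m} {n} {F} F-ext F0 = begin
    sumFun F
      ≈⟨ sumFun-∷ F-ext ⟩
    sumFun {m} (λ f → F (zero ∷ f)) ∙ sum (λ a → sumFun {m} (λ f → F (suc a ∷ f)))
      ≈⟨ ∙-cong (trans (sumFun-cong {m} (λ f → F0 (zero ∷ f) zero ≡.refl)) (sum-replicate-zero (suc n ℕ.^ m)))
                (sum-cong-≋ {n} (λ a → sumFun-nonzero {m} (F-ext ∘ ∷-cong (suc a)) (λ f i → F0 (suc a ∷ f) (suc i)))) ⟩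
    ε ∙ sum (λ a → sumFun {m} {n} (λ f → F (suc a ∷ (suc ∘ f))))
      ≈⟨ identityˡ _ ⟩
    sum (λ a → sumFun {m} {n} (λ f → F (suc a ∷ (suc ∘ f))))
      ≈⟨ sum-cong-≋ {n} (λ a → sumFun-cong {m} (λ f → F-ext (suc-∷ a f))) ⟩
    sum (λ a → sumFun {m} (λ f → F (suc ∘ (a ∷ f))))
      ≈⟨ sumFun-∷ (λ f≗g → F-ext (≡.cong suc ∘ f≗g)) ⟨
    sumFun (λ f → F (suc ∘ f)) ∎
    where
    suc-∷ : ∀ a (f : Fin m → Fin n) → suc a ∷ (suc ∘ f) ≗ suc ∘ (a ∷ f)
    suc-∷ a f zero    = ≡.refl
    suc-∷ a f (suc i) = ≡.refl

module FiniteProducts {c ℓ} (R : CommutativeSemiring c ℓ) where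
  open CommutativeSemiring R hiding (zero)
  open import Algebra.Properties.Semiring.Sum semiring
  open import Algebra.Properties.CommutativeMonoid.Sum *-commutativeMonoid using ()
    renaming (sum to product; sum-cong-≋ to product-cong)
  open FiniteSums +-commutativeMonoid
  open import Relation.Binary.Reasoning.Setoid setoid

  sumFun-*ˡ : ∀ {m n} x (F : (Fin m → Fin n) → Carrier) → x * sumFun F ≈ sumFun (λ f → x * F f)
  sumFun-*ˡ {m} {n} x F = *-distribˡ-sum {n ℕ.^ m} x (F ∘ finToFun)

  sumFun-*ʳ : ∀ {m n} x (F : (Fin m → Fin n) → Carrier) → sumFun F * x ≈ sumFun (λ f → F f * x)
  sumFun-*ʳ {m} {n} x F = *-distribʳ-sum {n ℕ.^ m} x (F ∘ finToFun)

  sumFun-product : ∀ {m n} (g : Fin m → Fin n → Carrier) →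
                   sumFun (λ f → product (λ i → g i (f i))) ≈ product (λ i → sum (g i))
  sumFun-product {zero}      g = +-identityʳ 1#
  sumFun-product {suc m} {n} g = begin
    sumFun (λ f → product (λ i → g i (f i)))
      ≈⟨ sumFun-∷ {m} (λ f≗f′ → product-cong {suc m} (λ i → reflexive (≡.cong (g i) (f≗f′ i)))) ⟩
    sum (λ a → sumFun (λ f → g zero a * product (λ i → g (suc i) (f i))))
      ≈⟨ sum-cong-≋ {n} (λ a → sumFun-*ˡ {m} {n} (g zero a) (λ f → product (λ i → g (suc i) (f i)))) ⟨
    sum (λ a → g zero a * sumFun (λ f → product (λ i → g (suc i) (f i))))
      ≈⟨ *-distribʳ-sum {n} (sumFun {m} {n} (λ f → product (λ i → g (suc i) (f i)))) (g zero) ⟨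
    sum (g zero) * sumFun (λ f → product (λ i → g (suc i) (f i)))
      ≈⟨ *-congˡ (sumFun-product (g ∘ suc)) ⟩
    product (λ i → sum (g i)) ∎

  -- A function on `Fin (m * k)` consists of m independent blocks of length k. For k = 3 the blocks
  -- are the corners around the vertices.
  sumFun-blocks : ∀ m {k n} (g : Fin m → (Fin k → Fin n) → Carrier) → (∀ i → Extensional (g i)) →
                  sumFun (λ f → product (λ i → g i (λ j → f (combine i j)))) ≈ product (λ i → sumFun (g i))
  sumFun-blocks zero            g g-ext = +-identityʳ 1#
  sumFun-blocks (suc m) {k} {n} g g-ext = begin
    sumFun (λ f → product (λ i → g i (λ j → f (combine i j))))
      ≈⟨ sumFun-++ k {m ℕ.* k} (λ f≗f′ → product-cong {suc m} (λ i → g-ext i (λ j → f≗f′ (combine i j)))) ⟩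
    sumFun {k} (λ f → sumFun {m ℕ.* k} (λ h → product {suc m} (λ i → g i (λ j → (f ++ h) (combine i j)))))
      ≈⟨ sumFun-cong {k} (λ f → sumFun-cong {m ℕ.* k} (λ h → *-cong
           (g-ext zero (λ j → ≡.cong [ f , h ] (splitAt-↑ˡ k j (m ℕ.* k))))
           (product-cong {m} (λ i → g-ext (suc i) (λ j → ≡.cong [ f , h ] (splitAt-↑ʳ k (m ℕ.* k) (combine i j))))))) ⟩
    sumFun {k} (λ f → sumFun (λ h → g zero f * rest h))
      ≈⟨ sumFun-cong {k} (λ f → sumFun-*ˡ (g zero f) rest) ⟨
    sumFun (λ f → g zero f * sumFun rest)
      ≈⟨ sumFun-*ʳ (sumFun rest) (g zero) ⟨
    sumFun (g zero) * sumFun rest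
      ≈⟨ *-congˡ (sumFun-blocks m (g ∘ suc) (g-ext ∘ suc)) ⟩
    product (λ i → sumFun (g i)) ∎
    where
    rest : (Fin (m ℕ.* k) → Fin n) → Carrier
    rest h = product (λ i → g (suc i) (λ j → h (combine i j)))

open ≡ using (refl; sym; trans; cong; cong₂; subst)
open import Data.Nat using (_+_; _*_; _^_; _%_)
open Graph
open RotationSystem

ℤ-semiring : CommutativeSemiring 0ℓ 0ℓ
ℤ-semiring = ℤ.+-*-commutativeSemiring

open CommutativeSemiring ℤ-semiring using (semiring; +-commutativeMonoid; *-commutativeMonoid)
open import Algebra.Properties.Semiring.Sum semiring using ()
  renaming (sum to ∑ᶻ; sum-cong-≗ to ∑ᶻ-cong; ∑-comm to ∑ᶻ-comm; ∑-distrib-+ to ∑ᶻ-distrib-+; *-distribˡ-sum to *-distribˡ-∑ᶻ)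
open import Algebra.Properties.CommutativeMonoid.Sum *-commutativeMonoid using ()
  renaming (sum to ∏; sum-cong-≗ to ∏-cong; ∑-distrib-+ to ∏-distrib-*)
open import Algebra.Properties.Semiring.Sum ℕ.+-*-semiring using (∑-comm; ∑-distrib-+)
  renaming (sum-cong-≗ to ∑-cong; *-distribʳ-sum to *-distribʳ-∑)
open FiniteSums +-commutativeMonoid using (sumFun; sumFun-reindex; sumFun-cong)
open FiniteProducts ℤ-semiring using (sumFun-product; sumFun-blocks; sumFun-*ˡ)
module ∑ = FiniteSums ℕ.+-0-commutativeMonoid
module ∏ = FiniteSums *-commutativeMonoid

-- The signed sum over orientations as a sum over colourings

-- The value 1F is agreement with `clockwise`, so -1 marks the edges whose number is tested for
-- parity.
sign : Fin 2 → ℤ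
sign 0F = 1ℤ
sign 1F = -1ℤ

next₃ : Fin 3 → Fin 3
next₃ 0F = 1F
next₃ 1F = 2F
next₃ 2F = 0F

prev₃ : Fin 3 → Fin 3
prev₃ 0F = 2F
prev₃ 1F = 0F
prev₃ 2F = 1F

-- On differences d ∈ {−1,0,1} the indicator of d + d′ = 0 is a bilinear form, and
-- it is integrally equivalent to diag(1,1,−1): the diagonal is η, and spin c a b
-- is the c-th new coordinate of the difference a − b.
η : Fin 3 → ℤ
η 0F = 1ℤ
η 1F = 1ℤ
η 2F = -1ℤ

spin : Fin 3 → Fin 2 → Fin 2 → ℤ
spin 0F 0F 0F = 1ℤ
spin 0F 0F 1F = 0ℤ
spin 0F 1F 0F = 1ℤ
spin 0F 1F 1F = 1ℤ
spin 1F 0F 0F = -1ℤ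
spin 1F 0F 1F = 1ℤ
spin 1F 1F 0F = 0ℤ
spin 1F 1F 1F = -1ℤ
spin 2F 0F 0F = 1ℤ
spin 2F 0F 1F = -1ℤ
spin 2F 1F 0F = 1ℤ
spin 2F 1F 1F = 1ℤ

-- The row index is the orientation of the corner before a dart and the column index that of the
-- corner after it. Each corner comes after exactly one dart, so its sign enters exactly once.
transfer : Fin 3 → Fin 2 → Fin 2 → ℤ
transfer c a b = sign b ℤ.* spin c a b

-- The transfer matrices are traceless, so this is alternating in the colours: it
-- is ±1 on permutations of the three colours and 0 elsewhere.
trace : Fin 3 → Fin 3 → Fin 3 → ℤ
trace c₀ c₁ c₂ = sumFun {3} {2} (λ a →
  transfer c₀ (a 2F) (a 0F) ℤ.* (transfer c₁ (a 0F) (a 1F) ℤ.* (transfer c₂ (a 1F) (a 2F) ℤ.* 1ℤ)))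

-- Here `pᵢ` and `bᵢ` are the orientations of the corners before and after the i-th dart of an edge
-- of `H`. With value 1F the former run into the edge and the latter out of it, so in-degree minus
-- out-degree is 2(p₀ + p₁ - b₀ - b₁).
Balanced : Fin 2 → Fin 2 → Fin 2 → Fin 2 → Set
Balanced p₀ b₀ p₁ b₁ = toℕ p₀ + toℕ p₁ ≡ toℕ b₀ + toℕ b₁

balanced? : ∀ p₀ b₀ p₁ b₁ → Dec (Balanced p₀ b₀ p₁ b₁)
balanced? p₀ b₀ p₁ b₁ = toℕ p₀ + toℕ p₁ ℕ.≟ toℕ b₀ + toℕ b₁

indicator : ∀ {p} {P : Set p} → Dec P → ℤ
indicator P? = if does P? then 1ℤ else 0ℤ

-- This is the diagonalised bilinear form, with the signs of the two later corners moved into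
-- `transfer`. The trailing factors `1ℤ` make the products definitionally those of `∏` over `Fin 2`.
signed-balanced : ∀ p₀ b₀ p₁ b₁ →
  sign b₀ ℤ.* (sign b₁ ℤ.* 1ℤ) ℤ.* indicator (balanced? p₀ b₀ p₁ b₁) ≡
  ∑ᶻ (λ c → η c ℤ.* (transfer c p₀ b₀ ℤ.* (transfer c p₁ b₁ ℤ.* 1ℤ)))
signed-balanced = from-yes (all? λ p₀ → all? λ b₀ → all? λ p₁ → all? λ b₁ →
  sign b₀ ℤ.* (sign b₁ ℤ.* 1ℤ) ℤ.* indicator (balanced? p₀ b₀ p₁ b₁) ℤ.≟
  ∑ᶻ (λ c → η c ℤ.* (transfer c p₀ b₀ ℤ.* (transfer c p₁ b₁ ℤ.* 1ℤ))))

module TransferSum {nV nE : ℕ} (darts : (Fin nV × Fin 3) ↔ (Fin nE × Fin 2))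
  (prev : Fin nE × Fin 2 → Fin nE × Fin 2)
  (prev-darts : ∀ v j → prev (Inverse.to darts (v , j)) ≡ Inverse.to darts (v , prev₃ j)) where

  at : ∀ {A : Set} → (Fin (nE * 2) → A) → Fin nE × Fin 2 → A
  at α d = α (uncurry combine d)

  dart : Fin nV → Fin 3 → Fin nE × Fin 2
  dart v j = Inverse.to darts (v , j)

  edge : Fin nV → Fin 3 → Fin nE
  edge v j = proj₁ (dart v j)

  weight : (Fin nE → Fin 3) → (Fin (nE * 2) → Fin 2) → Fin nE × Fin 2 → ℤ
  weight c α d = transfer (c (proj₁ d)) (at α (prev d)) (at α d)

  weight-cong : ∀ c {α β} → α ≗ β → ∀ d → weight c α d ≡ weight c β d
  weight-cong c α≗β d = cong₂ (transfer (c (proj₁ d))) (α≗β _) (α≗β _)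

  -- For fixed c, a corner's orientation occurs in two factors only, both at the same vertex: as
  -- column index at its own dart and as row index at the next dart. Hence the sum splits over the
  -- vertices, and each vertex contributes a trace of three matrices in cyclic order.
  sumFun-weight : ∀ c → sumFun (λ α → ∏ (λ e → ∏ (λ i → weight c α (e , i)))) ≡
                        ∏ (λ v → trace (c (edge v 0F)) (c (edge v 1F)) (c (edge v 2F)))
  sumFun-weight c = begin
    sumFun (λ α → ∏ (λ e → ∏ (λ i → weight c α (e , i))))
      ≡⟨ sumFun-reindex (λ α≗β → ∏-cong {nE} (λ e → ∏-cong (λ i → weight-cong c α≗β (e , i)))) ρ ⟩
    sumFun (λ β → ∏ (λ e → ∏ (λ i → weight c (β ∘ Inverse.to ρ) (e , i))))
      ≡⟨ sumFun-cong {nV * 3} (λ β → ∏.sum-reindex (weight c (β ∘ Inverse.to ρ)) darts) ⟩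
    sumFun (λ β → ∏ (λ v → ∏ (λ j → weight c (β ∘ Inverse.to ρ) (dart v j))))
      ≡⟨ sumFun-cong {nV * 3} (λ β → ∏-cong {nV} (λ v → ∏-cong {3} (λ j →
           cong₂ (transfer (c (edge v j))) (trans (cong (at (β ∘ Inverse.to ρ)) (prev-darts v j)) (at-ρ β v (prev₃ j))) (at-ρ β v j)))) ⟩
    sumFun (λ β → ∏ (λ v → ∏ (λ j → transfer (c (edge v j)) (β (combine v (prev₃ j))) (β (combine v j)))))
      ≡⟨ sumFun-blocks nV (λ v (a : Fin 3 → Fin 2) → ∏ (λ j → transfer (c (edge v j)) (a (prev₃ j)) (a j)))
           (λ v a≗b → ∏-cong {3} (λ j → cong₂ (transfer (c (edge v j))) (a≗b (prev₃ j)) (a≗b j))) ⟩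
    ∏ (λ v → trace (c (edge v 0F)) (c (edge v 1F)) (c (edge v 2F))) ∎
    where
    open ≡-Reasoning
    ρ : Fin (nE * 2) ↔ Fin (nV * 3)
    ρ = ↔-sym *↔× ↔-∘ (↔-sym darts ↔-∘ *↔×)
    at-ρ : ∀ (β : Fin (nV * 3) → Fin 2) v j → at (β ∘ Inverse.to ρ) (dart v j) ≡ β (combine v j)
    at-ρ β v j = cong β (trans
      (cong (uncurry combine ∘ Inverse.from darts) (Inverse.strictlyInverseˡ (*↔× {nE} {2}) (dart v j)))
      (cong (uncurry combine) (Inverse.strictlyInverseʳ darts (v , j))))

  BalancedAt : (Fin (nE * 2) → Fin 2) → Fin nE → Set
  BalancedAt α e = Balanced (at α (prev (e , 0F))) (at α (e , 0F)) (at α (prev (e , 1F))) (at α (e , 1F))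

  balancedAt? : ∀ α e → Dec (BalancedAt α e)
  balancedAt? α e = balanced? (at α (prev (e , 0F))) (at α (e , 0F)) (at α (prev (e , 1F))) (at α (e , 1F))

  -- Expanding the product over edges of sums over `Fin 3` chooses an index at every edge, and these
  -- choices are the colourings. Once the two sums are exchanged, the orientations are summed out by
  -- `sumFun-weight`.
  signed-sum : sumFun (λ α → ∏ (sign ∘ α) ℤ.* ∏ (λ e → indicator (balancedAt? α e))) ≡
               sumFun {nE} {3} (λ c → ∏ (η ∘ c) ℤ.* ∏ (λ v → trace (c (edge v 0F)) (c (edge v 1F)) (c (edge v 2F))))
  signed-sum = begin
    sumFun (λ α → ∏ (sign ∘ α) ℤ.* ∏ (λ e → indicator (balancedAt? α e)))
      ≡⟨ sumFun-cong {nE * 2} (λ α → trans (cong (ℤ._* ∏ (λ e → indicator (balancedAt? α e))) (∏.sum-combine nE (sign ∘ α)))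
           (sym (∏-distrib-* {nE} (λ e → ∏ (λ i → sign (at α (e , i)))) (λ e → indicator (balancedAt? α e))))) ⟩
    sumFun (λ α → ∏ (λ e → ∏ (λ i → sign (at α (e , i))) ℤ.* indicator (balancedAt? α e)))
      ≡⟨ sumFun-cong {nE * 2} (λ α → ∏-cong {nE} (λ e → signed-balanced (at α (prev (e , 0F))) (at α (e , 0F)) (at α (prev (e , 1F))) (at α (e , 1F)))) ⟩
    sumFun (λ α → ∏ (λ e → ∑ᶻ (λ c → η c ℤ.* ∏ (λ i → transfer c (at α (prev (e , i))) (at α (e , i))))))
      ≡⟨ sumFun-cong {nE * 2} (λ α → sumFun-product (λ e c → η c ℤ.* ∏ (λ i → transfer c (at α (prev (e , i))) (at α (e , i))))) ⟨
    sumFun (λ α → sumFun {nE} {3} (λ c → ∏ (λ e → η (c e) ℤ.* ∏ (λ i → weight c α (e , i)))))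
      ≡⟨ ∑ᶻ-comm {2 ^ (nE * 2)} {3 ^ nE} _ ⟩
    sumFun (λ c → sumFun (λ α → ∏ (λ e → η (c e) ℤ.* ∏ (λ i → weight c α (e , i)))))
      ≡⟨ sumFun-cong {nE} (λ c → sumFun-cong {nE * 2} (λ α → ∏-distrib-* {nE} (η ∘ c) (λ e → ∏ (λ i → weight c α (e , i))))) ⟩
    sumFun (λ c → sumFun (λ α → ∏ (η ∘ c) ℤ.* ∏ (λ e → ∏ (λ i → weight c α (e , i)))))
      ≡⟨ sumFun-cong {nE} (λ c → sumFun-*ˡ {nE * 2} (∏ (η ∘ c)) (λ α → ∏ (λ e → ∏ (λ i → weight c α (e , i))))) ⟨
    sumFun (λ c → ∏ (η ∘ c) ℤ.* sumFun (λ α → ∏ (λ e → ∏ (λ i → weight c α (e , i)))))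
      ≡⟨ sumFun-cong {nE} (λ c → cong (∏ (η ∘ c) ℤ.*_) (sumFun-weight c)) ⟩
    sumFun (λ c → ∏ (η ∘ c) ℤ.* ∏ (λ v → trace (c (edge v 0F)) (c (edge v 1F)) (c (edge v 2F)))) ∎
    where open ≡-Reasoning

-- Darts of a cubic map

record Enumeration {n : ℕ} (P : Pred (Fin n) 0ℓ) (k : ℕ) : Set where
  field
    element   : Fin k → Fin n
    satisfies : ∀ i → P (element i)
    index     : ∀ {x} → P x → Fin k
    element-index : ∀ {x} (p : P x) → element (index p) ≡ x
    injective : ∀ {i j} → element i ≡ element j → i ≡ j

enumerate : ∀ {n} {P : Pred (Fin n) 0ℓ} (P? : Decidable P) → Enumeration P (count P?)
enumerate {zero}  P? = record
  { element = λ () ; satisfies = λ () ; index = λ { {()} } ; element-index = λ { {()} } ; injective = λ { {()} } }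
enumerate {suc n} P? with P? zero | enumerate (P? ∘ suc)
... | yes p | E = record
  { element       = λ { zero → zero ; (suc i) → suc (element i) }
  ; satisfies     = λ { zero → p ; (suc i) → satisfies i }
  ; index         = λ { {zero} q → zero ; {suc x} q → suc (index q) }
  ; element-index = λ { {zero} q → refl ; {suc x} q → cong suc (element-index q) }
  ; injective     = λ { {zero} {zero} eq → refl ; {suc i} {suc j} eq → cong suc (injective (suc-injective eq)) }
  }
  where open Enumeration E
... | no ¬p | E = record
  { element       = suc ∘ element
  ; satisfies     = satisfies
  ; index         = λ { {zero} q → contradiction q ¬p ; {suc x} q → index q }
  ; element-index = λ { {zero} q → contradiction q ¬p ; {suc x} q → cong suc (element-index q) }
  ; injective     = λ eq → injective (suc-injective eq)
  }
  where open Enumeration E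

iterate-preserves : ∀ {A : Set} (f : A → A) (S : A → Set) → (∀ {x} → S x → S (f x)) →
                    ∀ k {x} → S x → S (iterate f x k)
iterate-preserves f S S-f zero    Sx = Sx
iterate-preserves f S S-f (suc k) Sx = iterate-preserves f S S-f k (S-f Sx)

Transitive₃ : (Fin 3 → Fin 3) → Set
Transitive₃ σ = ∀ i j → ∃[ k ] iterate σ i k ≡ j

swap₁₂ : Fin 3 → Fin 3
swap₁₂ 0F = 0F
swap₁₂ 1F = 2F
swap₁₂ 2F = 1F

invariant-full : ∀ {σ} → Transitive₃ σ → (S : Fin 3 → Set) → (∀ i → S i → S (σ i)) →
                 ∀ {i} → S i → ∀ j → S j
invariant-full {σ} tr S S-σ {i} Si j with tr i j
... | k , refl = iterate-preserves σ S (λ {x} → S-σ x) k Si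

fixed-point-full : ∀ {σ i} → Transitive₃ σ → σ i ≡ i → ∀ j → j ≡ i
fixed-point-full {σ} {i} tr σi≡i = invariant-full tr (_≡ i) (λ { _ refl → σi≡i }) refl

two-cycle-full : ∀ {σ i j} → Transitive₃ σ → σ i ≡ j → σ j ≡ i → ∀ k → k ≡ i ⊎ k ≡ j
two-cycle-full {σ} {i} {j} tr σi≡j σj≡i =
  invariant-full tr (λ k → k ≡ i ⊎ k ≡ j) (λ { _ (inj₁ refl) → inj₂ σi≡j ; _ (inj₂ refl) → inj₁ σj≡i }) (inj₁ refl)

-- Every map on three points runs into a cycle of length 1, 2 or 3, and transitivity excludes the
-- first two. Of the two 3-cycles one is `next₃` and the other is its conjugate by a transposition,
-- so an involution τ suffices.
transitive⇒3-cycle : ∀ σ → Transitive₃ σ →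
                     ∃[ τ ] (∀ i → τ (τ i) ≡ i) × (∀ i → σ (τ i) ≡ τ (next₃ i))
transitive⇒3-cycle σ tr with σ 0F in e₀ | σ 1F in e₁ | σ 2F in e₂
... | 1F | 2F | 0F = id , (λ _ → refl) , λ { 0F → e₀ ; 1F → e₁ ; 2F → e₂ }
... | 2F | 0F | 1F = swap₁₂ , (λ { 0F → refl ; 1F → refl ; 2F → refl }) , λ { 0F → e₀ ; 1F → e₂ ; 2F → e₁ }
... | 0F | _  | _  = contradiction (fixed-point-full tr e₀ 1F) λ ()
... | 1F | 1F | _  = contradiction (fixed-point-full tr e₁ 0F) λ ()
... | 2F | 1F | _  = contradiction (fixed-point-full tr e₁ 0F) λ ()
... | 1F | 2F | 2F = contradiction (fixed-point-full tr e₂ 0F) λ ()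
... | 2F | _  | 2F = contradiction (fixed-point-full tr e₂ 0F) λ ()
... | 1F | 0F | _  = contradiction (two-cycle-full tr e₀ e₁ 2F) λ { (inj₁ ()) ; (inj₂ ()) }
... | 2F | _  | 0F = contradiction (two-cycle-full tr e₀ e₂ 1F) λ { (inj₁ ()) ; (inj₂ ()) }
... | _  | 2F | 1F = contradiction (two-cycle-full tr e₁ e₂ 0F) λ { (inj₁ ()) ; (inj₂ ()) }

module CubicMap (H : Graph) (R : RotationSystem H) (cubic : Cubic H) where

  code : Dart H → Fin (nE H * 2)
  code = uncurry combine

  decode : Fin (nE H * 2) → Dart H
  decode = remQuot 2

  decode-code : ∀ d → decode (code d) ≡ d
  decode-code (e , i) = remQuot-combine e i

  prev : Dart H → Dart H
  prev = Inverse.from (rotation R)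

  prev-next : ∀ d → prev (next R d) ≡ d
  prev-next = Inverse.strictlyInverseʳ (rotation R)

  At : Fin (nV H) → Pred (Fin (nE H * 2)) 0ℓ
  At v x = vertexOf H (decode x) ≡ v

  at? : ∀ v → Decidable (At v)
  at? v x = vertexOf H (decode x) ≟ v

  count-at : ∀ v → count (at? v) ≡ 3
  count-at v = begin
    count (at? v)
      ≡⟨ ∑.sum-remQuot (nE H) (λ d → if does (vertexOf H d ≟ v) then 1 else 0) ⟩
    ∑ (λ e → (if does (end H e 0F ≟ v) then 1 else 0) + ((if does (end H e 1F ≟ v) then 1 else 0) + 0))
      ≡⟨ ∑-cong {nE H} (λ e → cong ((if does (end H e 0F ≟ v) then 1 else 0) +_) (ℕ.+-identityʳ _)) ⟩
    ∑ (λ e → (if does (end H e 0F ≟ v) then 1 else 0) + (if does (end H e 1F ≟ v) then 1 else 0))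
      ≡⟨ ∑-distrib-+ {nE H} (λ e → if does (end H e 0F ≟ v) then 1 else 0) (λ e → if does (end H e 1F ≟ v) then 1 else 0) ⟩
    degree H v
      ≡⟨ cubic v ⟩
    3 ∎
    where open ≡-Reasoning

  record DartsAround (v : Fin (nV H)) : Set where
    field
      dartAt           : Fin 3 → Dart H
      dartAt-vertex    : ∀ i → vertexOf H (dartAt i) ≡ v
      position         : ∀ {d} → vertexOf H d ≡ v → Fin 3
      dartAt-position  : ∀ {d} (p : vertexOf H d ≡ v) → dartAt (position p) ≡ d
      dartAt-injective : ∀ {i j} → dartAt i ≡ dartAt j → i ≡ j
      next-dartAt      : ∀ i → next R (dartAt i) ≡ dartAt (next₃ i)

  module Around (v : Fin (nV H)) where
    open Enumeration (subst (Enumeration (At v)) (count-at v) (enumerate (at? v)))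

    code-at : ∀ {d} → vertexOf H d ≡ v → At v (code d)
    code-at {d} p = trans (cong (vertexOf H) (decode-code d)) p

    el : Fin 3 → Dart H
    el = decode ∘ element

    idx : ∀ {d} → vertexOf H d ≡ v → Fin 3
    idx p = index (code-at p)

    el-idx : ∀ {d} (p : vertexOf H d ≡ v) → el (idx p) ≡ d
    el-idx {d} p = trans (cong decode (element-index (code-at p))) (decode-code d)

    el-injective : ∀ {i j} → el i ≡ el j → i ≡ j
    el-injective {i} {j} eq = injective (begin
      element i            ≡⟨ combine-remQuot {nE H} 2 (element i) ⟨
      code (el i)          ≡⟨ cong code eq ⟩
      code (el j)          ≡⟨ combine-remQuot {nE H} 2 (element j) ⟩
      element j ∎)
      where open ≡-Reasoning

    next-at : ∀ i → vertexOf H (next R (el i)) ≡ v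
    next-at i = trans (next-vertex R (el i)) (satisfies i)

    -- The list `el` is ordered by code. `σ` is the rotation expressed in this list, and `τ`
    -- rearranges the list into the order of the rotation.
    σ : Fin 3 → Fin 3
    σ i = idx (next-at i)

    el-iterate : ∀ k i → el (iterate σ i k) ≡ iterate (next R) (el i) k
    el-iterate zero    i = refl
    el-iterate (suc k) i = trans (el-iterate k (σ i)) (cong (λ d → iterate (next R) d k) (el-idx (next-at i)))

    σ-transitive : Transitive₃ σ
    σ-transitive i j with next-cyclic R (el i) (el j) (trans (satisfies i) (sym (satisfies j)))
    ... | k , eq = k , el-injective (trans (el-iterate k i) eq)

    τ : Fin 3 → Fin 3
    τ = proj₁ (transitive⇒3-cycle σ σ-transitive)

    τ-involutive : ∀ i → τ (τ i) ≡ i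
    τ-involutive = proj₁ (proj₂ (transitive⇒3-cycle σ σ-transitive))

    dartsAround : DartsAround v
    dartsAround = record
      { dartAt           = el ∘ τ
      ; dartAt-vertex    = λ i → satisfies (τ i)
      ; position         = λ p → τ (idx p)
      ; dartAt-position  = λ p → trans (cong el (τ-involutive (idx p))) (el-idx p)
      ; dartAt-injective = λ eq → trans (sym (τ-involutive _)) (trans (cong τ (el-injective eq)) (τ-involutive _))
      ; next-dartAt      = λ i → trans (sym (el-idx (next-at (τ i)))) (cong el (proj₂ (proj₂ (transitive⇒3-cycle σ σ-transitive)) i))
      }

  -- Sealed, so that everything below rests on the fields of `DartsAround` and never unfolds the
  -- enumeration.
  abstract
    dartsAround : ∀ v → DartsAround v
    dartsAround = Around.dartsAround

  module _ (v : Fin (nV H)) where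
    open DartsAround (dartsAround v) public

  darts : (Fin (nV H) × Fin 3) ↔ Dart H
  darts = mk↔ₛ′ (uncurry dartAt) (λ d → vertexOf H d , position _ refl) (λ d → dartAt-position _ refl) left
    where
    left : ∀ vi → (vertexOf H (uncurry dartAt vi) , position _ refl) ≡ vi
    left (v , i) = lemma (vertexOf H (dartAt v i)) refl (dartAt-vertex v i)
      where
      -- `position` takes a proof about the vertex of the dart; with that vertex generalised to u,
      -- the equation u ≡ v can be matched with `refl`.
      lemma : ∀ u (p : vertexOf H (dartAt v i) ≡ u) → u ≡ v → (u , position u p) ≡ (v , i)
      lemma u p refl = cong (u ,_) (dartAt-injective u (dartAt-position u p))

  prev-dartAt : ∀ v i → prev (dartAt v i) ≡ dartAt v (prev₃ i)
  prev-dartAt v i = begin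
    prev (dartAt v i)                    ≡⟨ cong (prev ∘ dartAt v) (next₃-prev₃ i) ⟨
    prev (dartAt v (next₃ (prev₃ i)))    ≡⟨ cong prev (next-dartAt v (prev₃ i)) ⟨
    prev (next R (dartAt v (prev₃ i)))   ≡⟨ prev-next _ ⟩
    dartAt v (prev₃ i)                   ∎
    where
    open ≡-Reasoning
    next₃-prev₃ : ∀ i → next₃ (prev₃ i) ≡ i
    next₃-prev₃ 0F = refl
    next₃-prev₃ 1F = refl
    next₃-prev₃ 2F = refl

-- Counting

[_] : ∀ {P : Set} → Dec P → ℕ
[ P? ] = if does P? then 1 else 0

[yes] : ∀ {P : Set} (P? : Dec P) → P → [ P? ] ≡ 1
[yes] (yes _) p = refl
[yes] (no ¬p) p = contradiction p ¬p

∑-mono : ∀ {n} {f g : Fin n → ℕ} → (∀ i → f i ≤ g i) → ∑ f ≤ ∑ g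
∑-mono {zero}  f≤g = z≤n
∑-mono {suc n} f≤g = ℕ.+-mono-≤ (f≤g zero) (∑-mono (f≤g ∘ suc))

≤-∑ : ∀ {n} (f : Fin n → ℕ) i → f i ≤ ∑ f
≤-∑ f zero    = ℕ.m≤m+n _ _
≤-∑ f (suc i) = ℕ.≤-trans (≤-∑ (f ∘ suc) i) (ℕ.m≤n+m _ (f zero))

∑-zero : ∀ n → ∑ {n} (λ _ → 0) ≡ 0
∑-zero zero    = refl
∑-zero (suc n) = ∑-zero n

∑-one : ∀ n → ∑ {n} (λ _ → 1) ≡ n
∑-one zero    = refl
∑-one (suc n) = cong suc (∑-one n)

∑-single : ∀ {n} (f : Fin n → ℕ) a → ∑ (λ i → if does (i ≟ a) then f i else 0) ≡ f a
∑-single {suc n} f zero    = trans (cong (f zero +_) (∑-zero n)) (ℕ.+-identityʳ _)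
∑-single {suc n} f (suc a) = ∑-single (f ∘ suc) a

-- An empty count is 0, so an upper bound may be proved with an element at hand. For the fibres of
-- `∂ᶜ` that element serves as base point.
count-inhabited : ∀ {n k} {P : Pred (Fin n) 0ℓ} (P? : Decidable P) → (∀ i → P i → count P? ≤ k) → count P? ≤ k
count-inhabited {n} P? bound with any? P?
... | yes (i , p) = bound i p
... | no  ¬p      = ℕ.≤-trans (ℕ.≤-reflexive (trans (∑-cong {n} empty) (∑-zero n))) z≤n
  where
  empty : ∀ i → [ P? i ] ≡ 0
  empty i with P? i
  ... | yes p = contradiction (i , p) ¬p
  ... | no  _ = refl

-- Double counting of the pairs (i, j) with i ≡ g j: each i satisfying P lies in at least one pair,
-- each j in exactly one.
count-≤-cover : ∀ {n k} {P : Pred (Fin n) 0ℓ} (P? : Decidable P) (g : Fin k → Fin n) →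
                (∀ i → P i → ∃[ j ] i ≡ g j) → count P? ≤ k
count-≤-cover {n} {k} P? g cover = begin
  count P?                              ≤⟨ ∑-mono covered ⟩
  ∑ (λ i → ∑ (λ j → [ i ≟ g j ]))       ≡⟨ ∑-comm {n} {k} (λ i j → [ i ≟ g j ]) ⟩
  ∑ (λ j → ∑ (λ i → [ i ≟ g j ]))       ≡⟨ ∑-cong {k} (λ j → ∑-single (λ _ → 1) (g j)) ⟩
  ∑ (λ (j : Fin k) → 1)                 ≡⟨ ∑-one k ⟩
  k                                     ∎
  where
  open ℕ.≤-Reasoning
  covered : ∀ i → [ P? i ] ≤ ∑ (λ j → [ i ≟ g j ])
  covered i with P? i
  ... | no  _ = z≤n
  ... | yes p with cover i p
  ... | j , eq = ℕ.≤-trans (ℕ.≤-reflexive (sym ([yes] (i ≟ g j) eq))) (≤-∑ (λ j → [ i ≟ g j ]) j)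

-- The fibres over Z partition all n points and have at most k points each. The fibre over the
-- missed value is empty, which leaves room for k more.
missed-value-bound : ∀ {n m k} (t : Fin n → Fin m) {Z : Pred (Fin m) 0ℓ} (Z? : Decidable Z) →
                     (∀ j → Z (t j)) → (∀ i → count (λ j → t j ≟ i) ≤ k) →
                     ∀ {i₀} → Z i₀ → (∀ j → t j ≢ i₀) → n + k ≤ count Z? * k
missed-value-bound {n} {m} {k} t {Z} Z? t∈Z fibre≤k {i₀} i₀∈Z i₀∉t = begin
  n + k                                                                  ≡⟨ cong₂ _+_ total (sym (∑-single (λ _ → k) i₀)) ⟩
  ∑ (λ i → fibre i) + ∑ (λ i → if does (i ≟ i₀) then k else 0)           ≡⟨ ∑-distrib-+ {m} fibre _ ⟨
  ∑ (λ i → fibre i + (if does (i ≟ i₀) then k else 0))                   ≤⟨ ∑-mono bound ⟩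
  ∑ (λ i → [ Z? i ] * k)                                                 ≡⟨ *-distribʳ-∑ {m} k (λ i → [ Z? i ]) ⟨
  count Z? * k                                                           ∎
  where
  open ℕ.≤-Reasoning
  fibre : Fin m → ℕ
  fibre i = count (λ j → t j ≟ i)

  [≟]-sym : ∀ (a b : Fin m) → [ a ≟ b ] ≡ [ b ≟ a ]
  [≟]-sym a b with a ≟ b | b ≟ a
  ... | yes _ | yes _ = refl
  ... | no  _ | no  _ = refl
  ... | yes p | no ¬q = contradiction (sym p) ¬q
  ... | no ¬p | yes q = contradiction (sym q) ¬p

  total : n ≡ ∑ fibre
  total = sym (trans (∑-comm {m} {n} (λ i j → [ t j ≟ i ]))
    (trans (∑-cong {n} (λ j → trans (∑-cong {m} (λ i → [≟]-sym (t j) i)) (∑-single (λ _ → 1) (t j)))) (∑-one n)))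

  empty : ∀ {i} → (∀ j → t j ≢ i) → fibre i ≡ 0
  empty {i} i∉t = trans (∑-cong {n} (λ j → lemma j (t j ≟ i))) (∑-zero n)
    where
    lemma : ∀ j (d : Dec (t j ≡ i)) → [ d ] ≡ 0
    lemma j (yes p) = contradiction p (i∉t j)
    lemma j (no _) = refl

  bound : ∀ i → fibre i + (if does (i ≟ i₀) then k else 0) ≤ [ Z? i ] * k
  bound i with i ≟ i₀
  ... | yes refl rewrite empty i₀∉t | [yes] (Z? i₀) i₀∈Z = ℕ.≤-reflexive (sym (ℕ.+-identityʳ k))
  ... | no _ with Z? i
  ...   | yes _ = ℕ.≤-trans (ℕ.≤-reflexive (ℕ.+-identityʳ _)) (ℕ.≤-trans (fibre≤k i) (ℕ.≤-reflexive (sym (ℕ.+-identityʳ k))))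
  ...   | no ¬z = ℕ.≤-reflexive (trans (ℕ.+-identityʳ _) (empty (λ { j refl → ¬z (t∈Z j) })))

-- Cycles mod 2 are face boundaries

∏-zero : ∀ {n} (f : Fin n → ℤ) i → f i ≡ 0ℤ → ∏ f ≡ 0ℤ
∏-zero f zero    f0≡0 rewrite f0≡0 = ℤ.*-zeroˡ (∏ (f ∘ suc))
∏-zero f (suc i) fi≡0 rewrite ∏-zero (f ∘ suc) i fi≡0 = ℤ.*-zeroʳ (f zero)

∏-all : ∀ {n} {P : Pred (Fin n) 0ℓ} (P? : Decidable P) k →
        ∏ (λ i → if does (P? i) then ℤ.+ k else 0ℤ) ≡ (if does (all? P?) then ℤ.+ (k ^ n) else 0ℤ)
∏-all {n} {P} P? k = lemma (all? P?)
  where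
  holds : ∀ i (d : Dec (P i)) → P i → (if does d then ℤ.+ k else 0ℤ) ≡ ℤ.+ k
  holds i (yes _) _ = refl
  holds i (no ¬p) p = contradiction p ¬p
  fails : ∀ i (d : Dec (P i)) → ¬ P i → (if does d then ℤ.+ k else 0ℤ) ≡ 0ℤ
  fails i (yes p) ¬p = contradiction p ¬p
  fails i (no _)  _  = refl
  constant : ∀ m → ∏ {m} (λ _ → ℤ.+ k) ≡ ℤ.+ (k ^ m)
  constant zero    = refl
  constant (suc m) = trans (cong (ℤ.+ k ℤ.*_) (constant m)) (sym (ℤ.pos-* k (k ^ m)))
  lemma : (d : Dec (∀ i → P i)) → ∏ (λ i → if does (P? i) then ℤ.+ k else 0ℤ) ≡ (if does d then ℤ.+ (k ^ n) else 0ℤ)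
  lemma (yes p) = trans (∏-cong {n} (λ i → holds i (P? i) (p i))) (constant n)
  lemma (no ¬p) with ¬∀⟶∃¬ n P P? ¬p
  ... | i , ¬pᵢ = ∏-zero _ i (fails i (P? i) ¬pᵢ)

pos-∑ : ∀ {n} (f : Fin n → ℕ) → ℤ.+ ∑ f ≡ ∑ᶻ (λ i → ℤ.+ f i)
pos-∑ {zero}  f = refl
pos-∑ {suc n} f = trans (ℤ.pos-+ (f zero) (∑ (f ∘ suc))) (cong (ℤ._+_ (ℤ.+ f zero)) (pos-∑ (f ∘ suc)))

∑ᶻ-if : ∀ {n} {P : Pred (Fin n) 0ℓ} (P? : Decidable P) k →
        ∑ᶻ (λ i → if does (P? i) then ℤ.+ k else 0ℤ) ≡ ℤ.+ (k * count P?)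
∑ᶻ-if {n} P? k = begin
  ∑ᶻ (λ i → if does (P? i) then ℤ.+ k else 0ℤ)    ≡⟨ ∑ᶻ-cong {n} (λ i → scaled (does (P? i))) ⟩
  ∑ᶻ (λ i → ℤ.+ k ℤ.* ℤ.+ [ P? i ])               ≡⟨ *-distribˡ-∑ᶻ {n} (ℤ.+ k) (λ i → ℤ.+ [ P? i ]) ⟨
  ℤ.+ k ℤ.* ∑ᶻ (λ i → ℤ.+ [ P? i ])               ≡⟨ cong (ℤ.+ k ℤ.*_) (pos-∑ (λ i → [ P? i ])) ⟨
  ℤ.+ k ℤ.* ℤ.+ count P?                          ≡⟨ ℤ.pos-* k (count P?) ⟨
  ℤ.+ (k * count P?)                              ∎
  where
  open ≡-Reasoning
  scaled : ∀ b → (if b then ℤ.+ k else 0ℤ) ≡ ℤ.+ k ℤ.* ℤ.+ (if b then 1 else 0)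
  scaled true  = sym (ℤ.*-identityʳ (ℤ.+ k))
  scaled false = sym (ℤ.*-zeroʳ (ℤ.+ k))

infixl 6 _⊕_
_⊕_ : Fin 2 → Fin 2 → Fin 2
0F ⊕ b = b
1F ⊕ b = opposite b

-- The characters of 𝔽₂, as the symmetric pairing (-1)^(ab).
χ : Fin 2 → Fin 2 → ℤ
χ 0F _ = 1ℤ
χ 1F b = sign b

χ-orthogonal₂ : ∀ a b → ∑ᶻ (λ x → χ a x ℤ.* (χ b x ℤ.* 1ℤ)) ≡ (if does (a ≟ b) then ℤ.+ 2 else 0ℤ)
χ-orthogonal₂ = from-yes (all? λ a → all? λ b →
  ∑ᶻ (λ x → χ a x ℤ.* (χ b x ℤ.* 1ℤ)) ℤ.≟ (if does (a ≟ b) then ℤ.+ 2 else 0ℤ))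

χ-orthogonal₃ : ∀ a b c → ∑ᶻ (λ x → χ x a ℤ.* (χ x b ℤ.* (χ x c ℤ.* 1ℤ))) ≡
                (if does (a ⊕ b ⊕ c ≟ 0F) then ℤ.+ 2 else 0ℤ)
χ-orthogonal₃ = from-yes (all? λ a → all? λ b → all? λ c →
  ∑ᶻ (λ x → χ x a ℤ.* (χ x b ℤ.* (χ x c ℤ.* 1ℤ))) ℤ.≟ (if does (a ⊕ b ⊕ c ≟ 0F) then ℤ.+ 2 else 0ℤ))

module Homology (H : Graph) (R : RotationSystem H) (cubic : Cubic H) where
  open CubicMap H R cubic

  edgeAt : Fin (nV H) → Fin 3 → Fin (nE H)
  edgeAt v j = proj₁ (dartAt v j)

  Cycle : Pred (Fin (nE H) → Fin 2) 0ℓ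
  Cycle z = ∀ v → z (edgeAt v 0F) ⊕ z (edgeAt v 1F) ⊕ z (edgeAt v 2F) ≡ 0F

  cycle? : Decidable Cycle
  cycle? z = all? (λ v → z (edgeAt v 0F) ⊕ z (edgeAt v 1F) ⊕ z (edgeAt v 2F) ≟ 0F)

  Cocycle : Pred (Fin (nV H) → Fin 2) 0ℓ
  Cocycle y = ∀ e → y (end H e 0F) ≡ y (end H e 1F)

  cocycle? : Decidable Cocycle
  cocycle? y = all? (λ e → y (end H e 0F) ≟ y (end H e 1F))

  -- This is -1 to the number of darts at which both z and y take the value 1. Grouped by edges it
  -- is a character in z, trivial exactly when y is a cocycle; grouped by vertices it is a character
  -- in y, trivial exactly when z is a cycle.
  pairing : (Fin (nE H) → Fin 2) → (Fin (nV H) → Fin 2) → ℤ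
  pairing z y = ∏ (λ e → ∏ (λ i → χ (y (end H e i)) (z e)))

  sum-pairing-z : ∀ y → sumFun (λ z → pairing z y) ≡ (if does (cocycle? y) then ℤ.+ (2 ^ nE H) else 0ℤ)
  sum-pairing-z y = begin
    sumFun (λ z → pairing z y)
      ≡⟨ sumFun-product (λ e b → ∏ (λ i → χ (y (end H e i)) b)) ⟩
    ∏ (λ e → ∑ᶻ (λ b → ∏ (λ i → χ (y (end H e i)) b)))
      ≡⟨ ∏-cong {nE H} (λ e → χ-orthogonal₂ (y (end H e 0F)) (y (end H e 1F))) ⟩
    ∏ (λ e → if does (y (end H e 0F) ≟ y (end H e 1F)) then ℤ.+ 2 else 0ℤ)
      ≡⟨ ∏-all (λ e → y (end H e 0F) ≟ y (end H e 1F)) 2 ⟩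
    (if does (cocycle? y) then ℤ.+ (2 ^ nE H) else 0ℤ) ∎
    where open ≡-Reasoning

  sum-pairing-y : ∀ z → sumFun (λ y → pairing z y) ≡ (if does (cycle? z) then ℤ.+ (2 ^ nV H) else 0ℤ)
  sum-pairing-y z = begin
    sumFun (λ y → pairing z y)
      ≡⟨ sumFun-cong {nV H} (λ y → ∏.sum-reindex (λ d → χ (y (vertexOf H d)) (z (proj₁ d))) darts) ⟩
    sumFun (λ y → ∏ (λ v → ∏ (λ j → χ (y (vertexOf H (dartAt v j))) (z (edgeAt v j)))))
      ≡⟨ sumFun-cong {nV H} (λ y → ∏-cong {nV H} (λ v → ∏-cong {3} (λ j →
           cong (λ u → χ (y u) (z (edgeAt v j))) (dartAt-vertex v j)))) ⟩
    sumFun (λ y → ∏ (λ v → ∏ (λ j → χ (y v) (z (edgeAt v j)))))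
      ≡⟨ sumFun-product (λ v a → ∏ (λ j → χ a (z (edgeAt v j)))) ⟩
    ∏ (λ v → ∑ᶻ (λ a → ∏ (λ j → χ a (z (edgeAt v j)))))
      ≡⟨ ∏-cong {nV H} (λ v → χ-orthogonal₃ (z (edgeAt v 0F)) (z (edgeAt v 1F)) (z (edgeAt v 2F))) ⟩
    ∏ (λ v → if does (z (edgeAt v 0F) ⊕ z (edgeAt v 1F) ⊕ z (edgeAt v 2F) ≟ 0F) then ℤ.+ 2 else 0ℤ)
      ≡⟨ ∏-all (λ v → z (edgeAt v 0F) ⊕ z (edgeAt v 1F) ⊕ z (edgeAt v 2F) ≟ 0F) 2 ⟩
    (if does (cycle? z) then ℤ.+ (2 ^ nV H) else 0ℤ) ∎
    where open ≡-Reasoning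

  -- Both sides are the sum of `pairing` over all z and y, evaluated in the two orders of summation.
  cycle-count : 2 ^ nV H * countFun cycle? ≡ 2 ^ nE H * countFun cocycle?
  cycle-count = ℤ.+-injective (begin
    ℤ.+ (2 ^ nV H * countFun cycle?)
      ≡⟨ ∑ᶻ-if {2 ^ nE H} (λ i → cycle? (finToFun i)) (2 ^ nV H) ⟨
    sumFun (λ z → if does (cycle? z) then ℤ.+ (2 ^ nV H) else 0ℤ)
      ≡⟨ sumFun-cong {nE H} sum-pairing-y ⟨
    sumFun (λ z → sumFun (λ y → pairing z y))
      ≡⟨ ∑ᶻ-comm {2 ^ nE H} {2 ^ nV H} (λ i j → pairing (finToFun i) (finToFun j)) ⟩
    sumFun (λ y → sumFun (λ z → pairing z y))
      ≡⟨ sumFun-cong {nV H} sum-pairing-z ⟩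
    sumFun (λ y → if does (cocycle? y) then ℤ.+ (2 ^ nE H) else 0ℤ)
      ≡⟨ ∑ᶻ-if {2 ^ nV H} (λ i → cocycle? (finToFun i)) (2 ^ nE H) ⟩
    ℤ.+ (2 ^ nE H * countFun cocycle?) ∎)
    where open ≡-Reasoning

⊕-comm : ∀ a b → a ⊕ b ≡ b ⊕ a
⊕-comm = from-yes (all? λ a → all? λ b → a ⊕ b ≟ b ⊕ a)

⊕-cancel : ∀ a b → b ⊕ (a ⊕ b) ≡ a
⊕-cancel = from-yes (all? λ a → all? λ b → b ⊕ (a ⊕ b) ≟ a)

⊕-exchange : ∀ a b c d → a ⊕ b ≡ c ⊕ d → a ⊕ c ≡ b ⊕ d
⊕-exchange = from-yes (all? λ a → all? λ b → all? λ c → all? λ d → (a ⊕ b ≟ c ⊕ d) →-dec (a ⊕ c ≟ b ⊕ d))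

⊕-cyclic : ∀ a b c → (a ⊕ b) ⊕ (b ⊕ c) ⊕ (c ⊕ a) ≡ 0F
⊕-cyclic = from-yes (all? λ a → all? λ b → all? λ c → (a ⊕ b) ⊕ (b ⊕ c) ⊕ (c ⊕ a) ≟ 0F)

module FacePotential (H : Graph) (R : RotationSystem H) (cubic : Cubic H) (planar : Planar R) where
  open CubicMap H R cubic
  open Homology H R cubic
  open Planar planar

  face : Dart H → Fin nF
  face = Bijection.to countFaces

  component : Fin (nV H) → Fin nC
  component = Bijection.to countComps

  faceDart : Fin nF → Dart H
  faceDart k = proj₁ (Bijection.strictlySurjective countFaces k)

  face-faceDart : ∀ k → face (faceDart k) ≡ k
  face-faceDart k = proj₂ (Bijection.strictlySurjective countFaces k)

  root : Fin nC → Fin (nV H)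
  root c = proj₁ (Bijection.strictlySurjective countComps c)

  component-root : ∀ c → component (root c) ≡ c
  component-root c = proj₂ (Bijection.strictlySurjective countComps c)

  -- Face tracing leads from `otherEnd H d` to `next R d`. Thus d and `next R d` lie on the faces at
  -- the two sides of the edge of d. The case split lets `opposite` compute.
  face-next : ∀ d → face (next R d) ≡ face (otherEnd H d)
  face-next (e , 0F) = sym (Bijection.cong countFaces (return {y = next R (e , 0F)} refl))
  face-next (e , 1F) = sym (Bijection.cong countFaces (return {y = next R (e , 1F)} refl))

  -- The cellular boundary map mod 2 from faces to edges: the two darts of an edge lie on the faces
  -- at its two sides.
  ∂ : (Fin nF → Fin 2) → Fin (nE H) → Fin 2
  ∂ φ e = φ (face (e , 0F)) ⊕ φ (face (e , 1F))

  ∂-dart : ∀ φ d → ∂ φ (proj₁ d) ≡ φ (face d) ⊕ φ (face (next R d))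
  ∂-dart φ d@(e , 0F) = cong (λ k → φ (face d) ⊕ φ k) (sym (face-next d))
  ∂-dart φ d@(e , 1F) = trans (⊕-comm _ (φ (face d))) (cong (λ k → φ (face d) ⊕ φ k) (sym (face-next d)))

  ∂-dartAt : ∀ φ v j → ∂ φ (edgeAt v j) ≡ φ (face (dartAt v j)) ⊕ φ (face (dartAt v (next₃ j)))
  ∂-dartAt φ v j = trans (∂-dart φ (dartAt v j)) (cong (λ d → φ (face (dartAt v j)) ⊕ φ (face d)) (next-dartAt v j))

  -- Around a vertex the three values are successive differences of φ in cyclic order, so they
  -- telescope.
  ∂-cycle : ∀ φ → Cycle (∂ φ)
  ∂-cycle φ v rewrite ∂-dartAt φ v 0F | ∂-dartAt φ v 1F | ∂-dartAt φ v 2F =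
    ⊕-cyclic (φ (face (dartAt v 0F))) (φ (face (dartAt v 1F))) (φ (face (dartAt v 2F)))

  module _ (θ : Dart H → Fin 2) (θ-next : ∀ d → θ (next R d) ≡ θ d) (θ-ends : ∀ e → θ (e , 0F) ≡ θ (e , 1F)) where

    constant-at-vertex : ∀ {d d′} → vertexOf H d ≡ vertexOf H d′ → θ d ≡ θ d′
    constant-at-vertex {d} {d′} eq with next-cyclic R d d′ eq
    ... | k , refl = sym (iterate-preserves (next R) (λ x → θ x ≡ θ d) (λ {x} p → trans (θ-next x) p) k refl)

    constant-along : ∀ {u v} → EqClosure (λ u v → ∃[ e ] (end H e 0F ≡ u × end H e 1F ≡ v)) u v →
                     ∀ {d d′} → vertexOf H d ≡ u → vertexOf H d′ ≡ v → θ d ≡ θ d′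
    constant-along Star.ε p q = constant-at-vertex (trans p (sym q))
    constant-along (fwd (e , a , b) ◅ path) p q =
      trans (constant-at-vertex (trans p (sym a))) (trans (θ-ends e) (constant-along path b q))
    constant-along (bwd (e , a , b) ◅ path) p q =
      trans (constant-at-vertex (trans p (sym b))) (trans (sym (θ-ends e)) (constant-along path a q))

    -- Applied to two functions on darts: the difference of two potentials with the same boundary,
    -- and a cocycle read off at the vertex of a dart.
    constant-on-component : ∀ {d d′} → component (vertexOf H d) ≡ component (vertexOf H d′) → θ d ≡ θ d′
    constant-on-component eq = constant-along (Bijection.injective countComps eq) refl refl

  -- The boundary map on codes, where values can be compared by `≟` and fibres counted.
  ∂ᶜ : Fin (2 ^ nF) → Fin (2 ^ nE H)
  ∂ᶜ j = funToFin (∂ (finToFun j))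

  ∂ᶜ-sound : ∀ {j z} → ∂ᶜ j ≡ funToFin z → ∂ (finToFun j) ≗ z
  ∂ᶜ-sound {j} {z} eq e = trans (sym (finToFun-funToFin (∂ (finToFun j)) e))
    (trans (cong (λ i → finToFun i e) eq) (finToFun-funToFin z e))

  -- Two sets of faces with equal boundary differ by a θ that is constant across edges and around
  -- vertices, hence on components. A member of the fibre is therefore determined by the base point
  -- `j₀` and one bit per component, read at a dart of its root.
  fibre-bound : ∀ i → count (λ j → ∂ᶜ j ≟ i) ≤ 2 ^ nC
  fibre-bound i = count-inhabited (λ j → ∂ᶜ j ≟ i) λ j₀ j₀∈ → count-≤-cover (λ j → ∂ᶜ j ≟ i)
    (λ m → funToFin (λ k → finToFun j₀ k ⊕ finToFun m (component (vertexOf H (faceDart k)))))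
    (λ j j∈ → cover j₀ j (trans j∈ (sym j₀∈)))
    where
    cover : ∀ j₀ j → ∂ᶜ j ≡ ∂ᶜ j₀ → ∃[ m ] j ≡ funToFin (λ k → finToFun j₀ k ⊕ finToFun {2} {nC} m (component (vertexOf H (faceDart k))))
    cover j₀ j eq = funToFin ψ , trans (sym (funToFin-finToFin {nF} j)) (funToFin-cong (λ k → sym (begin
      φ₀ k ⊕ finToFun (funToFin ψ) (component (vertexOf H (faceDart k)))
        ≡⟨ cong (φ₀ k ⊕_) (finToFun-funToFin ψ _) ⟩
      φ₀ k ⊕ ψ (component (vertexOf H (faceDart k)))
        ≡⟨ cong (φ₀ k ⊕_) (constant-on-component θ θ-next θ-ends
             (trans (cong component (dartAt-vertex _ 0F)) (component-root _))) ⟩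
      φ₀ k ⊕ θ (faceDart k)
        ≡⟨ cong (λ l → φ₀ k ⊕ (φ l ⊕ φ₀ l)) (face-faceDart k) ⟩
      φ₀ k ⊕ (φ k ⊕ φ₀ k)
        ≡⟨ ⊕-cancel (φ k) (φ₀ k) ⟩
      φ k ∎)))
      where
      open ≡-Reasoning
      φ₀ φ : Fin nF → Fin 2
      φ₀ = finToFun j₀
      φ = finToFun j
      θ : Dart H → Fin 2
      θ d = φ (face d) ⊕ φ₀ (face d)
      θ-ends : ∀ e → θ (e , 0F) ≡ θ (e , 1F)
      θ-ends e = ⊕-exchange (φ (face (e , 0F))) (φ (face (e , 1F))) (φ₀ (face (e , 0F))) (φ₀ (face (e , 1F))) (∂ᶜ-sound eq e)
      θ-next : ∀ d → θ (next R d) ≡ θ d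
      θ-next (e , 0F) = trans (cong (λ k → φ k ⊕ φ₀ k) (face-next (e , 0F))) (sym (θ-ends e))
      θ-next (e , 1F) = trans (cong (λ k → φ k ⊕ φ₀ k) (face-next (e , 1F))) (θ-ends e)
      ψ : Fin nC → Fin 2
      ψ c = θ (dartAt (root c) 0F)

  cocycle-bound : countFun cocycle? ≤ 2 ^ nC
  cocycle-bound = count-≤-cover (λ i → cocycle? (finToFun i)) (λ m → funToFin (finToFun m ∘ component)) cover
    where
    cover : ∀ i → Cocycle (finToFun i) → ∃[ m ] i ≡ funToFin (finToFun {2} {nC} m ∘ component)
    cover i y-cocycle = funToFin ψ , trans (sym (funToFin-finToFin {nV H} i)) (funToFin-cong (λ u → sym (begin
      finToFun (funToFin ψ) (component u)
        ≡⟨ finToFun-funToFin ψ _ ⟩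
      y (root (component u))
        -- Passing to darts is possible because every vertex of a cubic graph carries one.
        ≡⟨ cong y (dartAt-vertex _ 0F) ⟨
      y (vertexOf H (dartAt (root (component u)) 0F))
        ≡⟨ constant-on-component (y ∘ vertexOf H) (cong y ∘ next-vertex R) y-cocycle
             (trans (cong component (dartAt-vertex _ 0F)) (trans (component-root _) (sym (cong component (dartAt-vertex u 0F))))) ⟩
      y (vertexOf H (dartAt u 0F))
        ≡⟨ cong y (dartAt-vertex u 0F) ⟩
      y u ∎)))
      where
      open ≡-Reasoning
      y : Fin (nV H) → Fin 2
      y = finToFun i
      ψ : Fin nC → Fin 2
      ψ = y ∘ root

  -- Euler's formula enters here, through 2^(E + 2C) = 2^(V + F). The common factor `2 ^ nV H` is
  -- kept, which avoids a division.
  cycle-bound : 2 ^ nV H * (countFun cycle? * 2 ^ nC) ≤ 2 ^ nV H * 2 ^ nF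
  cycle-bound = begin
    2 ^ nV H * (countFun cycle? * 2 ^ nC)     ≡⟨ ℕ.*-assoc (2 ^ nV H) (countFun cycle?) (2 ^ nC) ⟨
    2 ^ nV H * countFun cycle? * 2 ^ nC       ≡⟨ cong (_* 2 ^ nC) cycle-count ⟩
    2 ^ nE H * countFun cocycle? * 2 ^ nC     ≤⟨ ℕ.*-monoˡ-≤ (2 ^ nC) (ℕ.*-monoʳ-≤ (2 ^ nE H) cocycle-bound) ⟩
    2 ^ nE H * 2 ^ nC * 2 ^ nC                ≡⟨ ℕ.*-assoc (2 ^ nE H) (2 ^ nC) (2 ^ nC) ⟩
    2 ^ nE H * (2 ^ nC * 2 ^ nC)              ≡⟨ cong (2 ^ nE H *_) (ℕ.^-distribˡ-+-* 2 nC nC) ⟨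
    2 ^ nE H * 2 ^ (nC + nC)                  ≡⟨ ℕ.^-distribˡ-+-* 2 (nE H) (nC + nC) ⟨
    2 ^ (nE H + (nC + nC))                    ≡⟨ cong (λ c → 2 ^ (nE H + (nC + c))) (ℕ.+-identityʳ nC) ⟨
    2 ^ (nE H + 2 * nC)                       ≡⟨ cong (2 ^_) euler ⟨
    2 ^ (nV H + nF)                           ≡⟨ ℕ.^-distribˡ-+-* 2 (nV H) nF ⟩
    2 ^ nV H * 2 ^ nF                         ∎
    where open ℕ.≤-Reasoning

  -- If a cycle were missed by `∂ᶜ`, the 2^F sets of faces in fibres of size at most 2^C would force
  -- 2^F + 2^C ≤ #cycles · 2^C, against `cycle-bound`.
  potential : ∀ z → Cycle z → ∃[ φ ] ∂ φ ≗ z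
  potential z z-cycle with any? (λ j → ∂ᶜ j ≟ funToFin z)
  ... | yes (j , eq) = finToFun j , ∂ᶜ-sound eq
  ... | no  missed   = contradiction (ℕ.≤-trans (ℕ.*-monoʳ-≤ (2 ^ nV H) bound) cycle-bound) (ℕ.<⇒≱ strict)
    where
    Cycle-cong : ∀ {z z′} → z ≗ z′ → Cycle z → Cycle z′
    Cycle-cong {z} {z′} eq p v = trans (sym (cong₂ _⊕_ (cong₂ _⊕_ (eq _) (eq _)) (eq _))) (p v)
    bound : 2 ^ nF + 2 ^ nC ≤ countFun cycle? * 2 ^ nC
    bound = missed-value-bound ∂ᶜ (λ i → cycle? (finToFun i))
      (λ j → Cycle-cong (λ e → sym (finToFun-funToFin (∂ (finToFun j)) e)) (∂-cycle (finToFun j)))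
      fibre-bound
      (Cycle-cong (λ e → sym (finToFun-funToFin z e)) z-cycle)
      (λ j eq → missed (j , eq))
    strict : 2 ^ nV H * 2 ^ nF < 2 ^ nV H * (2 ^ nF + 2 ^ nC)
    strict = ℕ.*-monoʳ-< (2 ^ nV H) {{ℕ.m^n≢0 2 (nV H)}} (ℕ.m<m+n (2 ^ nF) (ℕ.m^n>0 2 nC))

-- Colourings of plane cubic graphs

-- The colours as the nonzero vectors of 𝔽₂².
low high : Fin 3 → Fin 2
low 0F = 1F
low 1F = 0F
low 2F = 1F
high 0F = 0F
high 1F = 1F
high 2F = 1F

trace-aab : ∀ a b → trace a a b ≡ 0ℤ
trace-aab = from-yes (all? λ a → all? λ b → trace a a b ℤ.≟ 0ℤ)

trace-baa : ∀ a b → trace b a a ≡ 0ℤ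
trace-baa = from-yes (all? λ a → all? λ b → trace b a a ℤ.≟ 0ℤ)

trace-aba : ∀ a b → trace a b a ≡ 0ℤ
trace-aba = from-yes (all? λ a → all? λ b → trace a b a ℤ.≟ 0ℤ)

-- The prescribed differences determine the `xᵢ` up to flipping all three, and the flip leaves the
-- product unchanged since the `low` coordinates of three distinct colours sum to zero.
trace-potential : ∀ x₀ x₁ x₂ a b c → a ≢ b → b ≢ c → c ≢ a →
  x₀ ⊕ x₁ ≡ high a → x₁ ⊕ x₂ ≡ high b → x₂ ⊕ x₀ ≡ high c →
  trace a b c ≡ χ x₀ (low a) ℤ.* (χ x₁ (low b) ℤ.* (χ x₂ (low c) ℤ.* 1ℤ))
trace-potential = from-yes (all? λ x₀ → all? λ x₁ → all? λ x₂ → all? λ a → all? λ b → all? λ c →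
  ¬? (a ≟ b) →-dec ¬? (b ≟ c) →-dec ¬? (c ≟ a) →-dec
  (x₀ ⊕ x₁ ≟ high a) →-dec (x₁ ⊕ x₂ ≟ high b) →-dec (x₂ ⊕ x₀ ≟ high c) →-dec
  (trace a b c ℤ.≟ χ x₀ (low a) ℤ.* (χ x₁ (low b) ℤ.* (χ x₂ (low c) ℤ.* 1ℤ))))

-- The product is (-1)^((x + y) · low c), so `η c` is (-1)^(low c · high c): only the colour (1,1)
-- has sign -1.
η-potential : ∀ x y c → x ⊕ y ≡ high c → χ x (low c) ℤ.* (χ y (low c) ℤ.* 1ℤ) ≡ η c
η-potential = from-yes (all? λ x → all? λ y → all? λ c →
  (x ⊕ y ≟ high c) →-dec (χ x (low c) ℤ.* (χ y (low c) ℤ.* 1ℤ) ℤ.≟ η c))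

-- The three nonzero vectors of 𝔽₂² sum to zero. This makes `high ∘ c` a cycle when c is proper.
high-distinct : ∀ a b c → a ≢ b → b ≢ c → c ≢ a → high a ⊕ high b ⊕ high c ≡ 0F
high-distinct = from-yes (all? λ a → all? λ b → all? λ c →
  ¬? (a ≟ b) →-dec ¬? (b ≟ c) →-dec ¬? (c ≟ a) →-dec (high a ⊕ high b ⊕ high c ≟ 0F))

η-squared : ∀ c → η c ℤ.* η c ≡ 1ℤ
η-squared = from-yes (all? λ c → η c ℤ.* η c ℤ.≟ 1ℤ)

∏-one : ∀ n → ∏ {n} (λ _ → 1ℤ) ≡ 1ℤ
∏-one zero    = refl
∏-one (suc n) = trans (ℤ.*-identityˡ _) (∏-one n)

module ColouringWeight (H : Graph) (R : RotationSystem H) (cubic : Cubic H) (planar : Planar R) where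
  open CubicMap H R cubic
  open Homology H R cubic using (edgeAt)
  open FacePotential H R cubic planar

  traces : (Fin (nE H) → Fin 3) → ℤ
  traces c = ∏ (λ v → trace (c (edgeAt v 0F)) (c (edgeAt v 1F)) (c (edgeAt v 2F)))

  traces-proper : ∀ c → (∀ v j → c (edgeAt v j) ≢ c (edgeAt v (next₃ j))) → traces c ≡ ∏ (η ∘ c)
  traces-proper c proper = begin
    traces c
      ≡⟨ ∏-cong {nV H} (λ v → trace-potential (x (dartAt v 0F)) (x (dartAt v 1F)) (x (dartAt v 2F))
           (c (edgeAt v 0F)) (c (edgeAt v 1F)) (c (edgeAt v 2F)) (proper v 0F) (proper v 1F) (proper v 2F)
           (around v 0F) (around v 1F) (around v 2F)) ⟩
    ∏ (λ v → ∏ (λ j → χ (x (dartAt v j)) (low (c (edgeAt v j)))))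
      ≡⟨ ∏.sum-reindex (λ d → χ (x d) (low (c (proj₁ d)))) darts ⟨
    ∏ (λ e → ∏ (λ i → χ (x (e , i)) (low (c e))))
      ≡⟨ ∏-cong {nE H} (λ e → η-potential (x (e , 0F)) (x (e , 1F)) (c e) (proj₂ φ e)) ⟩
    ∏ (η ∘ c) ∎
    where
    open ≡-Reasoning
    φ : ∃[ φ ] ∂ φ ≗ high ∘ c
    φ = potential (high ∘ c) (λ v → high-distinct _ _ _ (proper v 0F) (proper v 1F) (proper v 2F))
    x : Dart H → Fin 2
    x = proj₁ φ ∘ face
    around : ∀ v j → x (dartAt v j) ⊕ x (dartAt v (next₃ j)) ≡ high (c (edgeAt v j))
    around v j = trans (sym (∂-dartAt (proj₁ φ) v j)) (proj₂ φ (edgeAt v j))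

  traces-improper : ∀ c v j → c (edgeAt v j) ≡ c (edgeAt v (next₃ j)) → traces c ≡ 0ℤ
  traces-improper c v j eq = ∏-zero _ v (vanish j eq)
    where
    vanish : ∀ j → c (edgeAt v j) ≡ c (edgeAt v (next₃ j)) → trace (c (edgeAt v 0F)) (c (edgeAt v 1F)) (c (edgeAt v 2F)) ≡ 0ℤ
    vanish 0F eq rewrite eq = trace-aab (c (edgeAt v 1F)) (c (edgeAt v 2F))
    vanish 1F eq rewrite eq = trace-baa (c (edgeAt v 2F)) (c (edgeAt v 0F))
    vanish 2F eq rewrite eq = trace-aba (c (edgeAt v 0F)) (c (edgeAt v 1F))

  proper-around : ∀ {c} → Proper (medialGraph R) 3 c → ∀ v j → c (edgeAt v j) ≢ c (edgeAt v (next₃ j))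
  proper-around {c} proper v j eq = proper (code (dartAt v j)) (begin
    c (proj₁ (decode (code (dartAt v j))))             ≡⟨ cong (c ∘ proj₁) (decode-code (dartAt v j)) ⟩
    c (edgeAt v j)                                     ≡⟨ eq ⟩
    c (edgeAt v (next₃ j))                             ≡⟨ cong (c ∘ proj₁) (next-dartAt v j) ⟨
    c (proj₁ (next R (dartAt v j)))                    ≡⟨ cong (c ∘ proj₁ ∘ next R) (decode-code (dartAt v j)) ⟨
    c (proj₁ (next R (decode (code (dartAt v j)))))    ∎)
    where open ≡-Reasoning

  around-proper : ∀ {c} → (∀ v j → c (edgeAt v j) ≢ c (edgeAt v (next₃ j))) → Proper (medialGraph R) 3 c
  around-proper {c} distinct x eq = distinct v j (begin
    c (edgeAt v j)                      ≡⟨ cong (c ∘ proj₁) (Inverse.strictlyInverseˡ darts (decode x)) ⟩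
    c (proj₁ (decode x))                ≡⟨ eq ⟩
    c (proj₁ (next R (decode x)))       ≡⟨ cong (c ∘ proj₁ ∘ next R) (Inverse.strictlyInverseˡ darts (decode x)) ⟨
    c (proj₁ (next R (dartAt v j)))     ≡⟨ cong (c ∘ proj₁) (next-dartAt v j) ⟩
    c (edgeAt v (next₃ j))              ∎)
    where
    open ≡-Reasoning
    v : Fin (nV H)
    v = proj₁ (Inverse.from darts (decode x))
    j : Fin 3
    j = proj₂ (Inverse.from darts (decode x))

  -- For proper c the weight is the square of the sign `∏ (η ∘ c)`. Otherwise two consecutive darts
  -- at some vertex have edges of the same colour, and the trace there vanishes.
  colouring-weight : ∀ c → ∏ (η ∘ c) ℤ.* traces c ≡ indicator (proper? (medialGraph R) 3 c)
  colouring-weight c = lemma (proper? (medialGraph R) 3 c)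
    where
    open ≡-Reasoning
    distinct? : ∀ v j → Dec (c (edgeAt v j) ≢ c (edgeAt v (next₃ j)))
    distinct? v j = ¬? (c (edgeAt v j) ≟ c (edgeAt v (next₃ j)))
    lemma : (d : Dec (Proper (medialGraph R) 3 c)) → ∏ (η ∘ c) ℤ.* traces c ≡ indicator d
    lemma (yes proper) = begin
      ∏ (η ∘ c) ℤ.* traces c             ≡⟨ cong (∏ (η ∘ c) ℤ.*_) (traces-proper c (proper-around {c} proper)) ⟩
      ∏ (η ∘ c) ℤ.* ∏ (η ∘ c)            ≡⟨ ∏-distrib-* {nE H} (η ∘ c) (η ∘ c) ⟨
      ∏ (λ e → η (c e) ℤ.* η (c e))      ≡⟨ ∏-cong {nE H} (η-squared ∘ c) ⟩
      ∏ {nE H} (λ _ → 1ℤ)              ≡⟨ ∏-one (nE H) ⟩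
      1ℤ                               ∎
    lemma (no ¬proper) with all? (λ v → all? (distinct? v))
    ... | yes p = contradiction (around-proper {c} p) ¬proper
    ... | no ¬p with ¬∀⟶∃¬ _ _ (λ v → all? (distinct? v)) ¬p
    ...   | v , ¬pᵥ with ¬∀⟶∃¬ _ _ (distinct? v) ¬pᵥ
    ...     | j , ¬pⱼ = trans
      (cong (∏ (η ∘ c) ℤ.*_) (traces-improper c v j (decidable-stable (_ ≟ _) ¬pⱼ))) (ℤ.*-zeroʳ (∏ (η ∘ c)))

-- Eulerian orientations and flows of the medial graph

sign-parity : ∀ {n} (α : Fin n → Fin 2) →
              ∏ (sign ∘ α) ≡ (if does (2 ∣? count (λ i → α i ≟ 1F)) then 1ℤ else -1ℤ)
sign-parity {zero}  α = refl
sign-parity {suc n} α with α zero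
... | 0F = trans (ℤ.*-identityˡ _) (sign-parity (α ∘ suc))
... | 1F = trans (cong (-1ℤ ℤ.*_) (sign-parity (α ∘ suc))) (flip (count (λ i → α (suc i) ≟ 1F)))
  where
  parity : ℕ → ℤ
  parity k = if does (2 ∣? k) then 1ℤ else -1ℤ
  parity-2+ : ∀ k → parity (2 + k) ≡ parity k
  parity-2+ k = cong (λ b → if b then 1ℤ else -1ℤ) (does-⇔
    (mk⇔ (λ d → ∣m+n∣m⇒∣n d ∣-refl) (λ d → ∣m∣n⇒∣m+n ∣-refl d)) (2 ∣? 2 + k) (2 ∣? k))
  flip : ∀ k → -1ℤ ℤ.* parity k ≡ parity (suc k)
  flip zero          = refl
  flip (suc zero)    = refl
  flip (suc (suc k)) = trans (cong (-1ℤ ℤ.*_) (parity-2+ k)) (trans (flip k) (sym (parity-2+ (suc k))))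

-- The right-hand side is the left-hand side with every orientation reversed, since tails are the
-- heads of the reversed orientation; hence the double `opposite`.
balanced-eulerian : ∀ p₀ b₀ p₁ b₁ →
  (toℕ p₀ + toℕ p₁) + (toℕ (opposite b₀) + toℕ (opposite b₁)) ≡
  (toℕ (opposite p₀) + toℕ (opposite p₁)) + (toℕ (opposite (opposite b₀)) + toℕ (opposite (opposite b₁))) ⇔
  Balanced p₀ b₀ p₁ b₁
balanced-eulerian p₀ b₀ p₁ b₁ = mk⇔ (forth p₀ b₀ p₁ b₁) (back p₀ b₀ p₁ b₁)
  where
  ins outs : Fin 2 → Fin 2 → Fin 2 → Fin 2 → ℕ
  ins p₀ b₀ p₁ b₁ = (toℕ p₀ + toℕ p₁) + (toℕ (opposite b₀) + toℕ (opposite b₁))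
  outs p₀ b₀ p₁ b₁ = ins (opposite p₀) (opposite b₀) (opposite p₁) (opposite b₁)
  forth : ∀ p₀ b₀ p₁ b₁ → ins p₀ b₀ p₁ b₁ ≡ outs p₀ b₀ p₁ b₁ → Balanced p₀ b₀ p₁ b₁
  forth = from-yes (all? λ p₀ → all? λ b₀ → all? λ p₁ → all? λ b₁ →
    (ins p₀ b₀ p₁ b₁ ℕ.≟ outs p₀ b₀ p₁ b₁) →-dec balanced? p₀ b₀ p₁ b₁)
  back : ∀ p₀ b₀ p₁ b₁ → Balanced p₀ b₀ p₁ b₁ → ins p₀ b₀ p₁ b₁ ≡ outs p₀ b₀ p₁ b₁
  back = from-yes (all? λ p₀ → all? λ b₀ → all? λ p₁ → all? λ b₁ →
    balanced? p₀ b₀ p₁ b₁ →-dec (ins p₀ b₀ p₁ b₁ ℕ.≟ outs p₀ b₀ p₁ b₁))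

-- The flow values 1 and 2 make both sides lie in {2,3,4}, where residues mod 3 determine the number.
balanced-flow : ∀ p₀ b₀ p₁ b₁ →
  (suc (toℕ p₀) + suc (toℕ p₁)) % 3 ≡ (suc (toℕ b₀) + suc (toℕ b₁)) % 3 ⇔ Balanced p₀ b₀ p₁ b₁
balanced-flow p₀ b₀ p₁ b₁ = mk⇔ (forth p₀ b₀ p₁ b₁) (back p₀ b₀ p₁ b₁)
  where
  flow : Fin 2 → Fin 2 → ℕ
  flow a b = (suc (toℕ a) + suc (toℕ b)) % 3
  forth : ∀ p₀ b₀ p₁ b₁ → flow p₀ p₁ ≡ flow b₀ b₁ → Balanced p₀ b₀ p₁ b₁
  forth = from-yes (all? λ p₀ → all? λ b₀ → all? λ p₁ → all? λ b₁ →
    (flow p₀ p₁ ℕ.≟ flow b₀ b₁) →-dec balanced? p₀ b₀ p₁ b₁)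
  back : ∀ p₀ b₀ p₁ b₁ → Balanced p₀ b₀ p₁ b₁ → flow p₀ p₁ ≡ flow b₀ b₁
  back = from-yes (all? λ p₀ → all? λ b₀ → all? λ p₁ → all? λ b₁ →
    balanced? p₀ b₀ p₁ b₁ →-dec (flow p₀ p₁ ℕ.≟ flow b₀ b₁))

if-+ : ∀ b x y → (if b then x else 0) + (if b then y else 0) ≡ (if b then x + y else 0)
if-+ true  x y = refl
if-+ false x y = refl

if-zero : ∀ b → (if b then 0 else 0) ≡ 0
if-zero true  = refl
if-zero false = refl

∀-⇔ : ∀ {A : Set} {P Q : A → Set} → (∀ x → P x ⇔ Q x) → (∀ x → P x) ⇔ (∀ x → Q x)
∀-⇔ P⇔Q = mk⇔ (λ p x → Equivalence.to (P⇔Q x) (p x)) (λ q x → Equivalence.from (P⇔Q x) (q x))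

≡-⇔ : ∀ {a b c d : ℕ} {P : Set} → a ≡ c → b ≡ d → c ≡ d ⇔ P → a ≡ b ⇔ P
≡-⇔ refl refl e = e

-- Here a stands for even agreement and b for being eulerian. The odd term is added on the right
-- rather than subtracted on the left, so that the summed identity descends from ℤ to ℕ.
signed-if : ∀ a b → ℤ.+ (if a ∧ b then 1 else 0) ≡
            (if a then 1ℤ else -1ℤ) ℤ.* (if b then 1ℤ else 0ℤ) ℤ.+ ℤ.+ (if not a ∧ b then 1 else 0)
signed-if true  true  = refl
signed-if true  false = refl
signed-if false true  = refl
signed-if false false = refl

module Medial (H : Graph) (R : RotationSystem H) (cubic : Cubic H) where
  open CubicMap H R cubic
  open TransferSum darts prev prev-dartAt using (at; BalancedAt; balancedAt?; signed-sum) public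

  G : Graph
  G = medialGraph R

  dart-sum : ∀ (g : Dart H → ℕ) e →
             ∑ (λ e′ → ∑ (λ i → if does (e′ ≟ e) then g (e′ , i) else 0)) ≡ g (e , 0F) + g (e , 1F)
  dart-sum g e = trans
    (∑-cong {nE H} (λ e′ → trans (cong ((if does (e′ ≟ e) then g (e′ , 0F) else 0) +_) (ℕ.+-identityʳ _)) (if-+ (does (e′ ≟ e)) (g (e′ , 0F)) (g (e′ , 1F)))))
    (∑-single (λ e′ → g (e′ , 0F) + g (e′ , 1F)) e)

  end₀-sum : ∀ (X : Fin (nE H * 2) → ℕ) e →
             ∑ (λ c → if does (medialEnd R c 0F ≟ e) then X c else 0) ≡ at X (e , 0F) + at X (e , 1F)
  end₀-sum X e = begin
    ∑ (λ c → if does (proj₁ (decode c) ≟ e) then X c else 0)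
      ≡⟨ ∑-cong {nE H * 2} (λ c → cong (λ x → if does (proj₁ (decode c) ≟ e) then X x else 0) (combine-remQuot {nE H} 2 c)) ⟨
    ∑ (λ c → if does (proj₁ (decode c) ≟ e) then at X (decode c) else 0)
      ≡⟨ ∑.sum-remQuot (nE H) (λ d → if does (proj₁ d ≟ e) then at X d else 0) ⟩
    ∑ (λ e′ → ∑ (λ i → if does (e′ ≟ e) then at X (e′ , i) else 0))
      ≡⟨ dart-sum (at X) e ⟩
    at X (e , 0F) + at X (e , 1F) ∎
    where open ≡-Reasoning

  -- The corners with end 1F at e are those represented by `prev d` for the darts d of e; reindexing
  -- along the rotation brings them to this form.
  end₁-sum : ∀ (X : Fin (nE H * 2) → ℕ) e →
             ∑ (λ c → if does (medialEnd R c 1F ≟ e) then X c else 0) ≡ at X (prev (e , 0F)) + at X (prev (e , 1F))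
  end₁-sum X e = begin
    ∑ (λ c → if does (proj₁ (next R (decode c)) ≟ e) then X c else 0)
      ≡⟨ ∑-cong {nE H * 2} (λ c → cong (λ x → if does (proj₁ (next R (decode c)) ≟ e) then X x else 0)
           (trans (cong code (prev-next (decode c))) (combine-remQuot {nE H} 2 c))) ⟨
    ∑ (λ c → if does (proj₁ (next R (decode c)) ≟ e) then at X (prev (next R (decode c))) else 0)
      ≡⟨ ∑.sum-remQuot (nE H) (λ d → if does (proj₁ (next R d) ≟ e) then at X (prev (next R d)) else 0) ⟩
    ∑ (λ e′ → ∑ (λ i → if does (proj₁ (next R (e′ , i)) ≟ e) then at X (prev (next R (e′ , i))) else 0))
      ≡⟨ ∑.sum-reindex (λ d → if does (proj₁ d ≟ e) then at X (prev d) else 0) (rotation R) ⟨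
    ∑ (λ e′ → ∑ (λ i → if does (e′ ≟ e) then at X (prev (e′ , i)) else 0))
      ≡⟨ dart-sum (at X ∘ prev) e ⟩
    at X (prev (e , 0F)) + at X (prev (e , 1F)) ∎
    where open ≡-Reasoning

  -- Used with β = α to count heads and with β = `opposite ∘ α` to count tails.
  chosen-ends : ∀ (β : Orientation G) e → count (λ c → medialEnd R c (β c) ≟ e) ≡
    (toℕ (at β (prev (e , 0F))) + toℕ (at β (prev (e , 1F)))) +
    (toℕ (opposite (at β (e , 0F))) + toℕ (opposite (at β (e , 1F))))
  chosen-ends β e = begin
    count (λ c → medialEnd R c (β c) ≟ e)
      ≡⟨ ∑-cong {nE H * 2} (λ c → split c (β c)) ⟩
    ∑ (λ c → (if does (medialEnd R c 1F ≟ e) then toℕ (β c) else 0) +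
             (if does (medialEnd R c 0F ≟ e) then toℕ (opposite (β c)) else 0))
      ≡⟨ ∑-distrib-+ {nE H * 2} (λ c → if does (medialEnd R c 1F ≟ e) then toℕ (β c) else 0) _ ⟩
    ∑ (λ c → if does (medialEnd R c 1F ≟ e) then toℕ (β c) else 0) +
    ∑ (λ c → if does (medialEnd R c 0F ≟ e) then toℕ (opposite (β c)) else 0)
      ≡⟨ cong₂ _+_ (end₁-sum (toℕ ∘ β) e) (end₀-sum (toℕ ∘ opposite ∘ β) e) ⟩
    _ ∎
    where
    open ≡-Reasoning
    split : ∀ c i → [ medialEnd R c i ≟ e ] ≡
      (if does (medialEnd R c 1F ≟ e) then toℕ i else 0) +
      (if does (medialEnd R c 0F ≟ e) then toℕ (opposite i) else 0)
    split c 0F = sym (cong (_+ [ medialEnd R c 0F ≟ e ]) (if-zero (does (medialEnd R c 1F ≟ e))))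
    split c 1F = sym (trans (cong ([ medialEnd R c 1F ≟ e ] +_) (if-zero (does (medialEnd R c 0F ≟ e)))) (ℕ.+-identityʳ _))

  eulerian-⇔ : ∀ α → Eulerian G α ⇔ (∀ e → BalancedAt α e)
  eulerian-⇔ α = ∀-⇔ λ e → ≡-⇔ (chosen-ends α e) (chosen-ends (opposite ∘ α) e)
    (balanced-eulerian (at α (prev (e , 0F))) (at α (e , 0F)) (at α (prev (e , 1F))) (at α (e , 1F)))

  -- Modulo 3, `suc ∘ α` is the flow with constant value -1 along the direction of α, so
  -- conservation at e compares in-degree with out-degree.
  flow-⇔ : ∀ (α : Orientation G) → NowhereZeroFlow G 3 (suc ∘ α) ⇔ (∀ e → BalancedAt α e)
  flow-⇔ α = mk⇔
    (λ nzf e → Equivalence.to (conservation e) (proj₂ nzf e))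
    (λ bal → (λ _ ()) , λ e → Equivalence.from (conservation e) (bal e))
    where
    conservation : ∀ e → flowThrough G {3} (suc ∘ α) 1F e % 3 ≡ flowThrough G {3} (suc ∘ α) 0F e % 3 ⇔ BalancedAt α e
    conservation e = ≡-⇔ (cong (_% 3) (end₁-sum (suc ∘ toℕ ∘ α) e)) (cong (_% 3) (end₀-sum (suc ∘ toℕ ∘ α) e))
      (balanced-flow (at α (prev (e , 0F))) (at α (e , 0F)) (at α (prev (e , 1F))) (at α (e , 1F)))

  flows≡eulerian : F[ G , 3 ] ≡ countFun (eulerian? G)
  flows≡eulerian = trans
    (∑.sumFun-nonzero {nE H * 2} {2} {λ f → [ nowhereZeroFlow? G 3 f ]} extensional vanishing)
    (∑.sumFun-cong {nE H * 2} (λ α → cong (λ b → if b then 1 else 0)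
      (trans (does-⇔ (flow-⇔ α) (nowhereZeroFlow? G 3 (suc ∘ α)) (all? (balancedAt? α)))
             (sym (does-⇔ (eulerian-⇔ α) (eulerian? G α) (all? (balancedAt? α)))))))
    where
    transport : ∀ {f g : Fin (nE G) → Fin 3} → f ≗ g → NowhereZeroFlow G 3 f → NowhereZeroFlow G 3 g
    transport {f} {g} f≗g (nz , cons) =
      (λ e ge≡0 → nz e (trans (cong toℕ (f≗g e)) ge≡0)) ,
      (λ v → trans (sym (through 1F v)) (trans (cons v) (through 0F v)))
      where
      through : ∀ s v → flowThrough G f s v % 3 ≡ flowThrough G g s v % 3
      through s v = cong (_% 3) (∑-cong {nE G} (λ e → cong (λ x → if does (end G e s ≟ v) then toℕ x else 0) (f≗g e)))
    extensional : ∑.Extensional (λ f → [ nowhereZeroFlow? G 3 f ])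
    extensional {f} {g} f≗g = cong (λ b → if b then 1 else 0)
      (does-⇔ (mk⇔ (transport f≗g) (transport (sym ∘ f≗g))) (nowhereZeroFlow? G 3 f) (nowhereZeroFlow? G 3 g))
    vanishing : ∀ f i → f i ≡ zero → [ nowhereZeroFlow? G 3 f ] ≡ 0
    vanishing f i fi≡0 = lemma (nowhereZeroFlow? G 3 f)
      where
      lemma : (d : Dec (NowhereZeroFlow G 3 f)) → [ d ] ≡ 0
      lemma (yes nzf) = contradiction (cong toℕ fi≡0) (proj₁ nzf i)
      lemma (no _)    = refl

  -- The clockwise orientation is a witness: at every edge of `H` two corners come in and two go
  -- out.
  eulerian-nonZero : NonZero (countFun (eulerian? G))
  eulerian-nonZero = ℕ.>-nonZero (ℕ.≤-trans (ℕ.≤-reflexive (sym ([yes] (eulerian? G (finToFun i)) eulerian)))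
    (≤-∑ (λ i → [ eulerian? G (finToFun i) ]) i))
    where
    i : Fin (2 ^ (nE H * 2))
    i = funToFin (clockwise R)
    one : ∀ d → toℕ (at (finToFun {2} i) d) ≡ 1
    one d = cong toℕ (finToFun-funToFin (clockwise R) (code d))
    eulerian : Eulerian G (finToFun i)
    eulerian = Equivalence.from (eulerian-⇔ (finToFun i)) (λ e → trans
      (cong₂ _+_ (one (prev (e , 0F))) (one (prev (e , 1F))))
      (sym (cong₂ _+_ (one (e , 0F)) (one (e , 1F)))))

module SignedCount (H : Graph) (R : RotationSystem H) (cubic : Cubic H) (planar : Planar R) where
  open Medial H R cubic
  open ColouringWeight H R cubic planar using (colouring-weight)

  even? : Decidable (AgreesEvenly G (clockwise R))
  even? = agreesEvenly? G (clockwise R)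

  weight : Orientation G → ℤ
  weight α = ∏ (sign ∘ α) ℤ.* ∏ (λ e → indicator (balancedAt? α e))

  weight-correct : ∀ α → ℤ.+ [ (even? ∩? eulerian? G) α ] ≡ weight α ℤ.+ ℤ.+ [ (∁? even? ∩? eulerian? G) α ]
  weight-correct α = trans (signed-if (does (even? α)) (does (eulerian? G α)))
    (cong (ℤ._+ ℤ.+ [ (∁? even? ∩? eulerian? G) α ]) (cong₂ ℤ._*_ (sym (sign-parity α)) (sym (begin
      ∏ (λ e → indicator (balancedAt? α e))
        ≡⟨ ∏-all (balancedAt? α) 1 ⟩
      (if does (all? (balancedAt? α)) then ℤ.+ (1 ^ nE H) else 0ℤ)
        ≡⟨ cong₂ (λ b n → if b then ℤ.+ n else 0ℤ)
             (sym (does-⇔ (eulerian-⇔ α) (eulerian? G α) (all? (balancedAt? α)))) (ℕ.^-zeroˡ (nE H)) ⟩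
      (if does (eulerian? G α) then 1ℤ else 0ℤ) ∎))))
    where open ≡-Reasoning

  weight-sum : sumFun weight ≡ ℤ.+ P[ G , 3 ]
  weight-sum = begin
    sumFun weight
      ≡⟨ signed-sum ⟩
    _
      ≡⟨ sumFun-cong {nE H} colouring-weight ⟩
    sumFun (λ c → indicator (proper? G 3 c))
      ≡⟨ ∑ᶻ-if (λ i → proper? G 3 (finToFun i)) 1 ⟩
    ℤ.+ (1 * P[ G , 3 ])
      ≡⟨ cong ℤ.+_ (ℕ.*-identityˡ P[ G , 3 ]) ⟩
    ℤ.+ P[ G , 3 ] ∎
    where open ≡-Reasoning

  even-odd-difference : countFun (even? ∩? eulerian? G) ≡ P[ G , 3 ] + countFun (∁? even? ∩? eulerian? G)
  even-odd-difference = ℤ.+-injective (begin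
    ℤ.+ countFun (even? ∩? eulerian? G)
      ≡⟨ pos-∑ {2 ^ nE G} (λ i → [ (even? ∩? eulerian? G) (finToFun i) ]) ⟩
    sumFun (λ α → ℤ.+ [ (even? ∩? eulerian? G) α ])
      ≡⟨ sumFun-cong {nE G} weight-correct ⟩
    sumFun (λ α → weight α ℤ.+ ℤ.+ [ (∁? even? ∩? eulerian? G) α ])
      ≡⟨ ∑ᶻ-distrib-+ {2 ^ nE G} (weight ∘ finToFun) (λ i → ℤ.+ [ (∁? even? ∩? eulerian? G) (finToFun i) ]) ⟩
    sumFun weight ℤ.+ sumFun (λ α → ℤ.+ [ (∁? even? ∩? eulerian? G) α ])
      ≡⟨ cong₂ ℤ._+_ weight-sum (sym (pos-∑ {2 ^ nE G} (λ i → [ (∁? even? ∩? eulerian? G) (finToFun i) ]))) ⟩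
    ℤ.+ P[ G , 3 ] ℤ.+ ℤ.+ countFun (∁? even? ∩? eulerian? G)
      ≡⟨ ℤ.pos-+ P[ G , 3 ] (countFun (∁? even? ∩? eulerian? G)) ⟨
    ℤ.+ (P[ G , 3 ] + countFun (∁? even? ∩? eulerian? G)) ∎)
    where open ≡-Reasoning

-- Rational arithmetic

open import Data.Integer using (+_)

/-+ : ∀ x y d .{{_ : NonZero d}} → (+ (x ℕ.+ y)) / d ≡ ((+ x) / d) ℚ.+ ((+ y) / d)
/-+ x y (suc d) = ℚ.toℚᵘ-injective (begin
  toℚᵘ ((+ (x ℕ.+ y)) / suc d)                       ≈⟨ ℚ.toℚᵘ-fromℚᵘ (mkℚᵘ (+ (x ℕ.+ y)) d) ⟩
  mkℚᵘ (+ (x ℕ.+ y)) d                               ≈⟨ *≡* (trans (cong (ℤ._* (+ suc d ℤ.* + suc d)) (ℤ.pos-+ x y))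
    (solve 3 (λ x y d → (x :+ y) :* (d :* d) := (x :* d :+ y :* d) :* d) refl (+ x) (+ y) (+ suc d))) ⟩
  mkℚᵘ (+ x) d ℚᵘ.+ mkℚᵘ (+ y) d                     ≈⟨ ℚᵘ.+-cong (ℚ.toℚᵘ-fromℚᵘ (mkℚᵘ (+ x) d)) (ℚ.toℚᵘ-fromℚᵘ (mkℚᵘ (+ y) d)) ⟨
  toℚᵘ ((+ x) / suc d) ℚᵘ.+ toℚᵘ ((+ y) / suc d)     ≈⟨ ℚ.toℚᵘ-homo-+ ((+ x) / suc d) ((+ y) / suc d) ⟨
  toℚᵘ ((+ x) / suc d ℚ.+ (+ y) / suc d)             ∎)
  where
  open ℚᵘ.≃-Reasoning
  open +-*-Solver

-- Serves to write P/2^|E| as (P/F) · (F/2^|E|), where the second factor is the probability of being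
-- eulerian.
/-*-cancel : ∀ x b d .{{_ : NonZero b}} .{{_ : NonZero d}} → (+ x) / d ≡ ((+ x) / b) ℚ.* ((+ b) / d)
/-*-cancel x (suc b) (suc d) = ℚ.toℚᵘ-injective (begin
  toℚᵘ ((+ x) / suc d)                                     ≈⟨ ℚ.toℚᵘ-fromℚᵘ (mkℚᵘ (+ x) d) ⟩
  mkℚᵘ (+ x) d                                             ≈⟨ *≡* (solve 3 (λ x b d → x :* (b :* d) := x :* b :* d) refl (+ x) (+ suc b) (+ suc d)) ⟩
  mkℚᵘ (+ x) b ℚᵘ.* mkℚᵘ (+ suc b) d                       ≈⟨ ℚᵘ.*-cong (ℚ.toℚᵘ-fromℚᵘ (mkℚᵘ (+ x) b)) (ℚ.toℚᵘ-fromℚᵘ (mkℚᵘ (+ suc b) d)) ⟨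
  toℚᵘ ((+ x) / suc b) ℚᵘ.* toℚᵘ ((+ suc b) / suc d)       ≈⟨ ℚ.toℚᵘ-homo-* ((+ x) / suc b) ((+ suc b) / suc d) ⟨
  toℚᵘ (((+ x) / suc b) ℚ.* ((+ suc b) / suc d))             ∎)
  where
  open ℚᵘ.≃-Reasoning
  open +-*-Solver

/-nonZero : ∀ b d .{{_ : NonZero b}} .{{_ : NonZero d}} → ℚ.NonZero ((+ b) / d)
/-nonZero b d = ℚ.pos⇒nonZero ((+ b) / d) {{ℚ.normalize-pos b d}}

÷-difference : ∀ p q s r .{{_ : ℚ.NonZero r}} → p ≡ q ℚ.* r ℚ.+ s → p ℚ.÷ r ℚ.- s ℚ.÷ r ≡ q
÷-difference p q s r refl = begin
  (q ℚ.* r ℚ.+ s) ℚ.* i ℚ.- s ℚ.* i              ≡⟨ cong (ℚ._- s ℚ.* i) (ℚ.*-distribʳ-+ i (q ℚ.* r) s) ⟩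
  q ℚ.* r ℚ.* i ℚ.+ s ℚ.* i ℚ.- s ℚ.* i          ≡⟨ ℚ.+-assoc (q ℚ.* r ℚ.* i) (s ℚ.* i) (ℚ.- (s ℚ.* i)) ⟩
  q ℚ.* r ℚ.* i ℚ.+ (s ℚ.* i ℚ.- s ℚ.* i)        ≡⟨ cong₂ ℚ._+_ (ℚ.*-assoc q r i) (ℚ.+-inverseʳ (s ℚ.* i)) ⟩
  q ℚ.* (r ℚ.* i) ℚ.+ ℚ.0ℚ                       ≡⟨ ℚ.+-identityʳ _ ⟩
  q ℚ.* (r ℚ.* i)                                ≡⟨ cong (q ℚ.*_) (ℚ.*-inverseʳ r) ⟩
  q ℚ.* ℚ.1ℚ                                     ≡⟨ ℚ.*-identityʳ q ⟩
  q                                              ∎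
  where
  open ≡-Reasoning
  i : ℚ
  i = ℚ.1/ r

-- The conditional bias as a ratio of colourings to flows

theorem5p1 : (H : Graph) (R : RotationSystem H) → Cubic H → Planar R →
    let G = medialGraph R
        γ = clockwise R
    in Σ[ Γ≢0 ∈ ℚ.NonZero (ℙ G (eulerian? G)) ]
       Σ[ F≢0 ∈ NonZero F[ G , 3 ] ]
         Bias G (agreesEvenly? G γ) (eulerian? G) {{Γ≢0}} ≡ _/_ (+ P[ G , 3 ]) F[ G , 3 ] {{F≢0}}
theorem5p1 H R cubic planar = Γ≢0 , F≢0 , ÷-difference (ℙ G (even? ∩? eulerian? G)) ((+ P[ G , 3 ]) / F[ G , 3 ])
  (ℙ G (∁? even? ∩? eulerian? G)) (ℙ G (eulerian? G)) (begin
    ℙ G (even? ∩? eulerian? G)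
      ≡⟨ ℚ./-cong (cong +_ even-odd-difference) refl ⟩
    (+ (P[ G , 3 ] + countFun (∁? even? ∩? eulerian? G))) / 2 ^ nE G
      ≡⟨ /-+ P[ G , 3 ] (countFun (∁? even? ∩? eulerian? G)) (2 ^ nE G) ⟩
    ((+ P[ G , 3 ]) / 2 ^ nE G) ℚ.+ ℙ G (∁? even? ∩? eulerian? G)
      -- The number of flows is inserted to bring the identity into the form q · ℙ(Γ) + s that
      -- `÷-difference` expects.
      ≡⟨ cong (ℚ._+ ℙ G (∁? even? ∩? eulerian? G)) (/-*-cancel P[ G , 3 ] F[ G , 3 ] (2 ^ nE G)) ⟩
    ((+ P[ G , 3 ]) / F[ G , 3 ]) ℚ.* ((+ F[ G , 3 ]) / 2 ^ nE G) ℚ.+ ℙ G (∁? even? ∩? eulerian? G)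
      ≡⟨ cong (λ r → ((+ P[ G , 3 ]) / F[ G , 3 ]) ℚ.* r ℚ.+ ℙ G (∁? even? ∩? eulerian? G))
           (ℚ./-cong (cong +_ flows≡eulerian) refl) ⟩
    ((+ P[ G , 3 ]) / F[ G , 3 ]) ℚ.* ℙ G (eulerian? G) ℚ.+ ℙ G (∁? even? ∩? eulerian? G) ∎)
  where
  open Medial H R cubic
  open SignedCount H R cubic planar
  open ≡-Reasoning
  instance
    N≢0 : NonZero (2 ^ nE G)
    N≢0 = ℕ.m^n≢0 2 (nE G)
    F≢0 : NonZero F[ G , 3 ]
    F≢0 = subst NonZero (sym flows≡eulerian) eulerian-nonZero
    Γ≢0 : ℚ.NonZero (ℙ G (eulerian? G))
    Γ≢0 = /-nonZero (countFun (eulerian? G)) (2 ^ nE G) {{eulerian-nonZero}}
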